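{- Let $D=(d_1,\dots,d_n)$ ($n\ge 1$) be the reduced degree sequence of some caterpillar, and let $\mathbb{C}_D$ be the set of all caterpillars with reduced degree sequence $D$. Then for every real $x>0$ and every $H\in\mathbb{C}_D$, $$M(\mathcal{S}(D),x)\le M(H,x).$$
   Context: All graphs are finite and simple. For a graph $G$, $m(G,k)$ is the number of matchings of $G$ with exactly $k$ edges ($m(G,0)=1$), and $M(G,x)=\sum_{k\ge0}m(G,k)x^k$. A caterpillar is a tree such that deleting all its leaves (degree-1 vertices) leaves a path, called the spine. The reduced degree sequence of a tree is the non-increasing sequence of the degrees of its non-leaf vertices (the degree sequence with all $1$'s removed). Definition of $\mathcal{S}(D)$: for $D=(d_1,\dots,d_n)$ with $d_1\ge\dots\ge d_n\ge2$, let $k=\lceil n/2\rceil$ and define $e_1,\dots,e_n$ by: for $1\le j\le k$, $e_j=d_j$ if $j$ is odd and $e_j=d_{n+2-j}$ if $j$ is even; for $k<j\le n$, $e_j=d_{n+2-j}$ if $n+1-j$ is odd and $e_j=d_j$ if $n+1-j$ is even. If $n=1$, $\mathcal{S}(D)$ is the star $K_{1,d_1}$. If $n\ge2$, $\mathcal{S}(D)$ is the caterpillar obtained from a path $v_1v_2\cdots v_n$ by attaching leaves so that $\deg(v_j)=e_j$ for all $j$ (i.e. $e_1-1$ and $e_n-1$ leaves at the ends, $e_j-2$ leaves at internal $v_j$). (For example, for $n\ge 5$ the spine degrees read $d_1,d_n,d_3,d_{n-2},\dots$ from the left end and $d_2,d_{n-1},d_4,d_{n-3},\dots$ from the right end.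)
   Formalization: The inequality is stated and proved for every rational x > 0 instead of every real x > 0. -}

module Defs where

open import Data.Bool using (Bool; true; false; if_then_else_)
open import Data.Nat as ℕ using (ℕ; zero; suc; _∸_; _<_; _≤ᵇ_; ⌈_/2⌉)
open import Data.Nat.Properties using (_≟_)
open import Data.List using (List; []; _∷_; _++_; map; length; filter; upTo)
open import Data.Nat.ListAction using (sum)
open import Data.List.Relation.Unary.All using (All)
open import Data.List.Relation.Unary.AllPairs using (AllPairs; allPairs?)
open import Data.List.Relation.Unary.Unique.Propositional using (Unique)
open import Data.List.Relation.Binary.Permutation.Propositional using (_↭_)
open import Data.List.Membership.Propositional using (_∈_)
open import Data.Product using (_×_; _,_; proj₁; proj₂; ∃; ∃-syntax)
open import Data.Sum using (_⊎_)
open import Data.Integer using (+_)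
open import Data.Rational using (ℚ; _/_; 0ℚ; 1ℚ; _+_; _*_)
open import Relation.Nullary using (¬_; Dec; yes; no; ¬?)
open import Relation.Nullary.Decidable using (_×-dec_; _⊎-dec_)
open import Relation.Binary.PropositionalEquality using (_≡_; _≢_)
open import Relation.Binary.Construct.Closure.ReflexiveTransitive using (Star)
open import Function.Bundles using (_⇔_)

-- Finite graphs: vertex set {0, …, V-1}, edges as a list of pairs.

Edge : Set
Edge = ℕ × ℕ

record Graph : Set where
  constructor graph
  field
    V : ℕ
    E : List Edge
open Graph public

WellFormed : Graph → Set
WellFormed G = All (λ e → proj₁ e < V G × proj₂ e < V G) (E G)

SameEdge : Edge → Edge → Set
SameEdge (a , b) (c , d) = (a ≡ c × b ≡ d) ⊎ (a ≡ d × b ≡ c)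

Simple : Graph → Set
Simple G = All (λ e → proj₁ e ≢ proj₂ e) (E G)
         × AllPairs (λ e f → ¬ SameEdge e f) (E G)

Adj : Graph → ℕ → ℕ → Set
Adj G u v = ((u , v) ∈ E G) ⊎ ((v , u) ∈ E G)

Connected : Graph → Set
Connected G = ∀ u v → u < V G → v < V G → Star (Adj G) u v

IsTree : Graph → Set
IsTree G = WellFormed G × Simple G × 1 ℕ.≤ V G × Connected G
         × ℕ.suc (length (E G)) ≡ V G

deg : Graph → ℕ → ℕ
deg G v = length (filter (λ e → (proj₁ e ≟ v) ⊎-dec (proj₂ e ≟ v)) (E G))

NonLeaf : Graph → ℕ → Set
NonLeaf G v = v < V G × deg G v ≢ 1

Consec : ℕ → ℕ → List ℕ → Set
Consec u v p = ∃[ xs ] ∃[ ys ] (p ≡ xs ++ (u ∷ v ∷ ys))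

SpineIsPath : Graph → Set
SpineIsPath G = ∃[ p ] (Unique p
  × (∀ v → (v ∈ p) ⇔ NonLeaf G v)
  × (∀ u v → u ∈ p → v ∈ p → Adj G u v ⇔ (Consec u v p ⊎ Consec v u p)))

IsCaterpillar : Graph → Set
IsCaterpillar G = IsTree G × SpineIsPath G

nonLeafDegrees : Graph → List ℕ
nonLeafDegrees G = map (deg G) (filter (λ v → ¬? (deg G v ≟ 1)) (upTo (V G)))

ReducedDegSeq : Graph → List ℕ → Set
ReducedDegSeq G D = AllPairs (λ a b → b ℕ.≤ a) D × (nonLeafDegrees G ↭ D)

sublists : {A : Set} → List A → List (List A)
sublists []       = [] ∷ []
sublists (x ∷ xs) = sublists xs ++ map (x ∷_) (sublists xs)

Disjoint : Edge → Edge → Set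
Disjoint (a , b) (c , d) = a ≢ c × a ≢ d × b ≢ c × b ≢ d

disjoint? : (e f : Edge) → Dec (Disjoint e f)
disjoint? (a , b) (c , d) =
  ¬? (a ≟ c) ×-dec ¬? (a ≟ d) ×-dec ¬? (b ≟ c) ×-dec ¬? (b ≟ d)

IsMatching : List Edge → Set
IsMatching S = AllPairs Disjoint S

m : Graph → ℕ → ℕ
m G k = length (filter (λ S → (length S ≟ k) ×-dec allPairs? disjoint? S)
                       (sublists (E G)))

ℕ→ℚ : ℕ → ℚ
ℕ→ℚ n = + n / 1

_^ℚ_ : ℚ → ℕ → ℚ
x ^ℚ zero  = 1ℚ
x ^ℚ suc k = x * (x ^ℚ k)

sumℚ : List ℚ → ℚ
sumℚ []       = 0ℚ
sumℚ (q ∷ qs) = q + sumℚ qs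

-- M(G,x) = Σ_{k=0}^{|E|} m(G,k) x^k  (m(G,k)=0 for k>|E|)
M : Graph → ℚ → ℚ
M G x = sumℚ (map (λ k → ℕ→ℚ (m G k) * (x ^ℚ k)) (upTo (suc (length (E G)))))

-- 1-indexed lookup, default 0
nth : List ℕ → ℕ → ℕ
nth []       _             = 0
nth (d ∷ ds) zero          = 0
nth (d ∷ ds) (suc zero)    = d
nth (d ∷ ds) (suc (suc j)) = nth ds (suc j)

isOdd : ℕ → Bool
isOdd zero          = false
isOdd (suc zero)    = true
isOdd (suc (suc j)) = isOdd j

-- e_j (1 ≤ j ≤ n) as in the definition of 𝒮(D)
eSeq : List ℕ → ℕ → ℕ
eSeq D j =
  let n = length D ; k = ⌈ n /2⌉ ; d = nth D in
  if j ≤ᵇ k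
    then (if isOdd j then d j else d ((2 ℕ.+ n) ∸ j))
    else (if isOdd ((1 ℕ.+ n) ∸ j) then d ((2 ℕ.+ n) ∸ j) else d j)

leafCount : List ℕ → ℕ → ℕ
leafCount D j with length D
... | suc zero = eSeq D j
... | n = if (j ≤ᵇ 1) Data.Bool.∨ (n ≤ᵇ j) then eSeq D j ∸ 1 else eSeq D j ∸ 2

attach : ℕ → ℕ → ℕ → List Edge
attach v c s = map (λ i → (v , s ℕ.+ i)) (upTo c)

leafEdges : List (ℕ × ℕ) → ℕ → List Edge
leafEdges []            s = []
leafEdges ((v , c) ∷ r) s = attach v c s ++ leafEdges r (s ℕ.+ c)

-- spine vertex v_j is the vertex j-1; leaves are n, n+1, …
𝒮 : List ℕ → Graph
𝒮 D = graph (n ℕ.+ sum (map proj₂ spec))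
            (map (λ i → (i , suc i)) (upTo (n ∸ 1)) ++ leafEdges spec n)
  where
    n = length D
    spec = map (λ i → (i , leafCount D (suc i))) (upTo n)

module Submission where

-- Prolonging the spine by one leaf at each end, M(G, x) of a caterpillar becomes the continuant
-- of the word 0, d - 2, …, d' - 2, 0 over the spine degrees, with letters 1 + c x and edge weight x.
-- Reversing a factor S of a word P S Q changes the continuant by x times the product of two
-- differences, whose signs compare the continued fractions of S with reverse S and of P with Q.
-- Distinct letters differ by at least x, which bounds the fractional parts, so these comparisons
-- are alternating-lexicographic. Hence bringing the extreme remaining letter to the left end, then
-- the next one to the right end, then working from the opposite extreme, never increases the
-- continuant; the word reached is that of 𝒮 D.

open import Defs
open import Data.Bool using (Bool; true; false; not; T; _∧_; if_then_else_)
open import Data.Bool.Properties using (∧-assoc; ∧-comm; ∧-identityʳ; ∧-zeroʳ)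
import Data.Integer as ℤ
open import Data.Integer.Solver using () renaming (module +-*-Solver to ℤ-Solver)
open import Data.List using (List; []; _∷_; _++_; [_]; map; length; filter; reverse; _ʳ++_; upTo; applyUpTo)
open import Data.List.Properties
  using (++-assoc; ++-identityʳ; ∷-injective; ʳ++-defn; unfold-reverse; reverse-++; reverse-involutive; reverse-map;
         length-++; length-map; length-reverse; length-upTo; filter-++; filter-all; filter-none; filter-accept; filter-reject;
         map-++; map-id; map-∘; map-upTo; upTo-∷ʳ; applyUpTo-∷ʳ)
open import Data.List.Membership.Propositional using (_∈_; _∉_)
open import Data.List.Membership.DecPropositional using () renaming (_∈?_ to member?)
open import Data.List.Membership.Propositional.Properties
  using (∈-++⁺ˡ; ∈-++⁺ʳ; ∈-++⁻; ∈-∃++; ∈-filter⁺; ∈-filter⁻; ∈-map⁺; ∈-map⁻; ∈-upTo⁺; ∈-upTo⁻)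
open import Data.List.Membership.Propositional.Properties.WithK using (unique∧set⇒bag)
open import Data.List.Relation.Binary.BagAndSetEquality using (∼bag⇒↭)
open import Data.List.Relation.Binary.Permutation.Propositional
  using (_↭_; ↭-refl; ↭-sym; ↭-trans; ↭-prep; ↭-reflexive; ↭⇒↭ₛ)
import Data.List.Relation.Binary.Permutation.Propositional.Properties as Permₚ
open Permₚ using (∈-resp-↭; All-resp-↭; drop-∷; shift; ∷↭∷ʳ; ++⁺ʳ; ↭-reverse; ↭-length; ↭-empty-inv; ↭-singleton-inv)
import Data.List.Relation.Binary.Permutation.Setoid.Properties as Permₛ
open import Data.List.Relation.Unary.All as All using (All; []; _∷_; all?)
import Data.List.Relation.Unary.All.Properties as Allₚ
open import Data.List.Relation.Unary.AllPairs as AllPairs using (AllPairs; []; _∷_; allPairs?)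
import Data.List.Relation.Unary.AllPairs.Properties as AllPairsₚ
open import Data.List.Relation.Unary.Any using (here; there)
open import Data.List.Relation.Unary.Unique.Propositional using (Unique)
import Data.List.Relation.Unary.Unique.Propositional.Properties as Uniqueₚ
open import Data.Nat as ℕ using (ℕ; zero; suc; _∸_; _≤ᵇ_; ⌈_/2⌉)
import Data.Nat.Properties as ℕₚ
open import Data.Product using (_×_; _,_; proj₁; proj₂; ∃-syntax)
open import Data.Rational using (ℚ; 0ℚ; 1ℚ; _<_; _≤_; _+_; _*_; _-_; -_; toℚᵘ; nonNegative; positive)
open import Data.Rational.Properties
open import Data.Rational.Solver using (module +-*-Solver)
import Data.Rational.Unnormalised as ℚᵘ
import Data.Rational.Unnormalised.Properties as ℚᵘₚ
open import Data.Sum as Sum using (_⊎_; inj₁; inj₂; [_,_]′)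
open import Function using (_∘_; id; const; _⇔_; mk⇔; Equivalence)
open import Relation.Binary.Construct.Closure.ReflexiveTransitive using (Star; ε; _◅_)
open import Relation.Binary.PropositionalEquality
  using (_≡_; _≢_; refl; sym; trans; cong; cong₂; subst; subst₂; setoid; module ≡-Reasoning)
open import Relation.Nullary using (¬_; Dec; yes; no; does; ¬?; contradiction)
open import Relation.Nullary.Decidable using (_×-dec_; _⊎-dec_; does-⇔; dec-true; dec-false)
open +-*-Solver using (solve; _:+_; _:*_; _:-_; :-_; _:=_; con)
open ℤ-Solver using () renaming (solve to ℤ-solve; con to ℤ-con; _:+_ to _ℤ:+_; _:*_ to _ℤ:*_; _:=_ to _ℤ:=_)

-- Continuants

-- An inner spine vertex of degree d carries d - 2 leaves, an end vertex d - 1. Counting one leaf at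
-- each end as part of the path makes every letter d - 2, so two caterpillars with the same degrees
-- give rearrangements of one word between fixed zeros. Reversing a factor S helps only if two signs
-- agree. If S ends with an extreme letter and starts with another one, the sign belonging to S is
-- decided by the first letters of S and its reversal. The sign belonging to the surroundings P and
-- Q is the obstacle, since letters of the unsorted middle also stand next to S. The induction
-- therefore carries a comparison that holds for every completion by remaining letters. Putting one
-- letter on each side adds a level to both continued fractions and reverses their order; this is
-- why the wanted extreme alternates. No caterpillar is brought to a normal form by an isomorphism.
-- The polynomial is computed from the edge list by deleting spine vertices in order, where only
-- degrees and adjacency along the spine matter.

0≤+ : ∀ {p q} → 0ℚ ≤ p → 0ℚ ≤ q → 0ℚ ≤ p + q
0≤+ = +-mono-≤

0≤* : ∀ {p q} → 0ℚ ≤ p → 0ℚ ≤ q → 0ℚ ≤ p * q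
0≤* {p} {q} 0≤p 0≤q =
  nonNegative⁻¹ (p * q) {{nonNeg*nonNeg⇒nonNeg p {{nonNegative 0≤p}} q {{nonNegative 0≤q}}}}

≤⇒0≤- : ∀ {p q} → p ≤ q → 0ℚ ≤ q - p
≤⇒0≤- {p} {q} p≤q = subst (_≤ q - p) (+-inverseʳ p) (+-monoˡ-≤ (- p) p≤q)

0≤-⇒≤ : ∀ {p q} → 0ℚ ≤ q - p → p ≤ q
0≤-⇒≤ {p} {q} 0≤ = subst₂ _≤_ (+-identityʳ p)
  (solve 2 (λ p q → p :+ (q :- p) := q) refl p q) (+-monoʳ-≤ p 0≤)

-- The pattern of most inequalities on continuants below: a visibly nonnegative expression, which
-- the ring solver identifies with the difference of the two sides.
≤-by-difference : ∀ {p q r} → 0ℚ ≤ r → r ≡ q - p → p ≤ q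
≤-by-difference 0≤r refl = 0≤-⇒≤ 0≤r

-- The fraction `+ n / 1` is normalised by a gcd, which does not compute for a variable `n`; hence
-- the detour through unnormalised rationals.
ℕ→ℚ-suc : ∀ n → ℕ→ℚ (suc n) ≡ 1ℚ + ℕ→ℚ n
ℕ→ℚ-suc n = toℚᵘ-injective (begin
  toℚᵘ (ℕ→ℚ (suc n))              ≈⟨ toℚᵘ-fromℚᵘ (ℚᵘ.mkℚᵘ (ℤ.+ suc n) 0) ⟩
  ℚᵘ.mkℚᵘ (ℤ.+ suc n) 0             ≈⟨ ℚᵘ.*≡* (ℤ-solve 1
    (λ n → (ℤ-con (ℤ.+ 1) ℤ:+ n) ℤ:* ℤ-con (ℤ.+ 1)
       ℤ:= (ℤ-con (ℤ.+ 1) ℤ:* ℤ-con (ℤ.+ 1) ℤ:+ n ℤ:* ℤ-con (ℤ.+ 1)) ℤ:* ℤ-con (ℤ.+ 1)) refl (ℤ.+ n)) ⟩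
  ℚᵘ.1ℚᵘ ℚᵘ.+ ℚᵘ.mkℚᵘ (ℤ.+ n) 0    ≈⟨ ℚᵘₚ.+-congʳ ℚᵘ.1ℚᵘ (ℚᵘₚ.≃-sym (toℚᵘ-fromℚᵘ (ℚᵘ.mkℚᵘ (ℤ.+ n) 0))) ⟩
  toℚᵘ 1ℚ ℚᵘ.+ toℚᵘ (ℕ→ℚ n)      ≈⟨ ℚᵘₚ.≃-sym (toℚᵘ-homo-+ 1ℚ (ℕ→ℚ n)) ⟩
  toℚᵘ (1ℚ + ℕ→ℚ n)              ∎)
  where open ℚᵘₚ.≃-Reasoning

0≤ℕ→ℚ : ∀ n → 0ℚ ≤ ℕ→ℚ n
0≤ℕ→ℚ zero    = ≤-refl
0≤ℕ→ℚ (suc n) = subst (0ℚ ≤_) (sym (ℕ→ℚ-suc n)) (0≤+ (nonNegative⁻¹ 1ℚ) (0≤ℕ→ℚ n))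

ℕ→ℚ-+ : ∀ k n → ℕ→ℚ (k ℕ.+ n) ≡ ℕ→ℚ k + ℕ→ℚ n
ℕ→ℚ-+ zero    n = sym (+-identityˡ (ℕ→ℚ n))
ℕ→ℚ-+ (suc k) n = begin
  ℕ→ℚ (suc (k ℕ.+ n))      ≡⟨ ℕ→ℚ-suc (k ℕ.+ n) ⟩
  1ℚ + ℕ→ℚ (k ℕ.+ n)       ≡⟨ cong (1ℚ +_) (ℕ→ℚ-+ k n) ⟩
  1ℚ + (ℕ→ℚ k + ℕ→ℚ n)     ≡⟨ sym (+-assoc 1ℚ (ℕ→ℚ k) (ℕ→ℚ n)) ⟩
  1ℚ + ℕ→ℚ k + ℕ→ℚ n       ≡⟨ cong (_+ ℕ→ℚ n) (sym (ℕ→ℚ-suc k)) ⟩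
  ℕ→ℚ (suc k) + ℕ→ℚ n      ∎
  where open ≡-Reasoning

module Continuant (x : ℚ) where

  b : ℕ → ℚ
  b c = 1ℚ + ℕ→ℚ c * x

  -- Matchings of a path whose vertices carry pendant edges: `b c` covers a vertex with `c` pendant
  -- edges that is not matched along the path, `x` stands for the edge to the next vertex. `K⁻`
  -- deletes the first vertex; its value 0 at `[]` says that there is no next vertex to match with.
  K K⁻ : List ℕ → ℚ
  K []       = 1ℚ
  K (a ∷ r)  = b a * K r + x * K⁻ r
  K⁻ []      = 0ℚ
  K⁻ (_ ∷ r) = K r

  -- The continuant of `reverse P ++ Q`, cut at the seam: the second summand collects the matchings
  -- that use the edge across it. Both words start at the seam, so letters can be moved across it
  -- one at a time.
  Φ : List ℕ → List ℕ → ℚ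
  Φ P Q = K P * K Q + x * (K⁻ P * K⁻ Q)

  Φ-comm : ∀ P Q → Φ P Q ≡ Φ Q P
  Φ-comm P Q = cong₂ _+_ (*-comm (K P) (K Q)) (cong (x *_) (*-comm (K⁻ P) (K⁻ Q)))

  Φ-shift : ∀ a P Q → Φ (a ∷ P) Q ≡ Φ P (a ∷ Q)
  Φ-shift a P Q = solve 6
    (λ x b p p⁻ q q⁻ → (b :* p :+ x :* p⁻) :* q :+ x :* (p :* q⁻)
                    := p :* (b :* q :+ x :* q⁻) :+ x :* (p⁻ :* q))
    refl x (b a) (K P) (K⁻ P) (K Q) (K⁻ Q)

  Φ-ʳ++ : ∀ S P Q → Φ (S ʳ++ P) Q ≡ Φ P (S ++ Q)
  Φ-ʳ++ []      P Q = refl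
  Φ-ʳ++ (a ∷ S) P Q = trans (Φ-ʳ++ S (a ∷ P) Q) (Φ-shift a P (S ++ Q))

  -- Reads the whole word from its other end, so that work at the right end becomes work at the left
  -- end.
  Φ-flip : ∀ S P Q → Φ P (S ++ Q) ≡ Φ Q (reverse S ++ P)
  Φ-flip S P Q = begin
    Φ P (S ++ Q)         ≡⟨ sym (Φ-ʳ++ S P Q) ⟩
    Φ (S ʳ++ P) Q        ≡⟨ Φ-comm (S ʳ++ P) Q ⟩
    Φ Q (S ʳ++ P)        ≡⟨ cong (Φ Q) (ʳ++-defn S) ⟩
    Φ Q (reverse S ++ P) ∎
    where open ≡-Reasoning

  K-Φ : ∀ Q → Φ [] Q ≡ K Q
  K-Φ Q = solve 3 (λ x q q⁻ → con 1ℚ :* q :+ x :* (con 0ℚ :* q⁻) := q) refl x (K Q) (K⁻ Q)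

  K-reverse : ∀ S → K (reverse S) ≡ K S
  K-reverse S = begin
    K (reverse S)         ≡⟨ sym (cong K (++-identityʳ (reverse S))) ⟩
    K (reverse S ++ [])   ≡⟨ sym (K-Φ (reverse S ++ [])) ⟩
    Φ [] (reverse S ++ []) ≡⟨ sym (Φ-flip S [] []) ⟩
    Φ [] (S ++ [])        ≡⟨ K-Φ (S ++ []) ⟩
    K (S ++ [])           ≡⟨ cong K (++-identityʳ S) ⟩
    K S                   ∎
    where open ≡-Reasoning

  -- Together with `K` and `K⁻` these are the entries of the transfer matrix of `S`, with rows (`K`,
  -- `x * β`) and (`K⁻`, `δ`); the values at `[]` form the identity matrix. On nonempty words `β` is
  -- the continuant without the last letter.
  β δ : List ℕ → ℚ
  β []      = 0ℚ
  β (a ∷ S) = b a * β S + δ S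
  δ []      = 1ℚ
  δ (a ∷ S) = x * β S

  K-++ : ∀ S Q → K (S ++ Q) ≡ K S * K Q + x * β S * K⁻ Q
  K⁻-++ : ∀ S Q → K⁻ (S ++ Q) ≡ K⁻ S * K Q + δ S * K⁻ Q
  K-++ []      Q = solve 3 (λ x q q⁻ → q := con 1ℚ :* q :+ x :* con 0ℚ :* q⁻) refl x (K Q) (K⁻ Q)
  K-++ (a ∷ S) Q = trans (cong₂ (λ k l → b a * k + x * l) (K-++ S Q) (K⁻-++ S Q))
    (solve 8 (λ x b s s⁻ β δ q q⁻ → b :* (s :* q :+ x :* β :* q⁻) :+ x :* (s⁻ :* q :+ δ :* q⁻)
                                 := (b :* s :+ x :* s⁻) :* q :+ x :* (b :* β :+ δ) :* q⁻)
      refl x (b a) (K S) (K⁻ S) (β S) (δ S) (K Q) (K⁻ Q))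
  K⁻-++ []      Q = solve 2 (λ q q⁻ → q⁻ := con 0ℚ :* q :+ con 1ℚ :* q⁻) refl (K Q) (K⁻ Q)
  K⁻-++ (a ∷ S) Q = K-++ S Q

  β-∷ʳ : ∀ S a → β (S ++ [ a ]) ≡ K S
  δ-∷ʳ : ∀ S a → δ (S ++ [ a ]) ≡ x * K⁻ S
  β-∷ʳ []      a = solve 1 (λ b → b :* con 0ℚ :+ con 1ℚ := con 1ℚ) refl (b a)
  β-∷ʳ (c ∷ S) a = cong₂ (λ k l → b c * k + l) (β-∷ʳ S a) (δ-∷ʳ S a)
  δ-∷ʳ []      a = refl
  δ-∷ʳ (c ∷ S) a = cong (x *_) (β-∷ʳ S a)

  β-reverse : ∀ S → β (reverse S) ≡ K⁻ S
  β-reverse []      = refl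
  β-reverse (a ∷ S) = begin
    β (reverse (a ∷ S))    ≡⟨ cong β (unfold-reverse a S) ⟩
    β (reverse S ++ [ a ]) ≡⟨ β-∷ʳ (reverse S) a ⟩
    K (reverse S)          ≡⟨ K-reverse S ⟩
    K S                    ∎
    where open ≡-Reasoning

  K⁻-reverse : ∀ S → K⁻ (reverse S) ≡ β S
  K⁻-reverse S = trans (sym (β-reverse (reverse S))) (cong β (reverse-involutive S))

  δ-reverse : ∀ S → δ (reverse S) ≡ δ S
  δ-reverse []      = refl
  δ-reverse (a ∷ S) = begin
    δ (reverse (a ∷ S))    ≡⟨ cong δ (unfold-reverse a S) ⟩
    δ (reverse S ++ [ a ]) ≡⟨ δ-∷ʳ (reverse S) a ⟩
    x * K⁻ (reverse S)     ≡⟨ cong (x *_) (K⁻-reverse S) ⟩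
    x * β S                ∎
    where open ≡-Reasoning

  Φ-++ : ∀ P S Q → Φ P (S ++ Q) ≡
         K P * (K S * K Q + x * β S * K⁻ Q) + x * (K⁻ P * (K⁻ S * K Q + δ S * K⁻ Q))
  Φ-++ P S Q = cong₂ (λ k l → K P * k + x * (K⁻ P * l)) (K-++ S Q) (K⁻-++ S Q)

  -- Up to the factor `x`, reversal transposes the transfer matrix: `β` and `K⁻` change places, `K`
  -- and `δ` stay.
  Φ-reverse-++ : ∀ P S Q → Φ P (reverse S ++ Q) ≡
         K P * (K S * K Q + x * K⁻ S * K⁻ Q) + x * (K⁻ P * (β S * K Q + δ S * K⁻ Q))
  Φ-reverse-++ P S Q = trans (Φ-++ P (reverse S) Q)
    (trans (cong₂ (λ k l → K P * (k * K Q + x * l * K⁻ Q) + x * (K⁻ P * (K⁻ (reverse S) * K Q + δ (reverse S) * K⁻ Q)))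
                  (K-reverse S) (β-reverse S))
           (cong₂ (λ k l → K P * (K S * K Q + x * K⁻ S * K⁻ Q) + x * (K⁻ P * (k * K Q + l * K⁻ Q)))
                  (K⁻-reverse S) (δ-reverse S)))

  -- K A / K⁻ A is the continued fraction of A, and _≼_ compares two of them.
  infix 4 _≼_
  _≼_ : List ℕ → List ℕ → Set
  A ≼ B = K A * K⁻ B ≤ K B * K⁻ A

  module _ (0<x : 0ℚ < x) where

    private
      0≤x : 0ℚ ≤ x
      0≤x = <⇒≤ 0<x

    0≤b-1 : ∀ c → 0ℚ ≤ ℕ→ℚ c * x
    0≤b-1 c = 0≤* (0≤ℕ→ℚ c) 0≤x

    0≤K : ∀ A → 0ℚ ≤ K A
    0≤K⁻ : ∀ A → 0ℚ ≤ K⁻ A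
    0≤K []      = nonNegative⁻¹ 1ℚ
    0≤K (a ∷ A) = 0≤+ (0≤* (0≤+ (nonNegative⁻¹ 1ℚ) (0≤b-1 a)) (0≤K A)) (0≤* 0≤x (0≤K⁻ A))
    0≤K⁻ []      = ≤-refl
    0≤K⁻ (_ ∷ A) = 0≤K A

    K⁻≤K : ∀ A → K⁻ A ≤ K A
    K⁻≤K []      = nonNegative⁻¹ 1ℚ
    K⁻≤K (a ∷ A) = ≤-by-difference (0≤+ (0≤* (0≤b-1 a) (0≤K A)) (0≤* 0≤x (0≤K⁻ A)))
      (solve 4 (λ x c k k⁻ → c :* k :+ x :* k⁻ := (con 1ℚ :+ c) :* k :+ x :* k⁻ :- k)
        refl x (ℕ→ℚ a * x) (K A) (K⁻ A))

    1≤K : ∀ A → 1ℚ ≤ K A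
    1≤K []      = ≤-refl
    1≤K (a ∷ A) = ≤-trans (1≤K A) (K⁻≤K (a ∷ A))

    b-< : ∀ {a c} → a ℕ.< c → 0ℚ ≤ b c - b a - x
    b-< {a} {c} a<c with ℕₚ.m≤n⇒∃[o]m+o≡n a<c
    ... | k , refl = subst (0ℚ ≤_) (sym eq) (0≤b-1 k)
      where
      eq : b (suc a ℕ.+ k) - b a - x ≡ ℕ→ℚ k * x
      eq = trans (cong (λ z → 1ℚ + z * x - b a - x)
                   (trans (ℕ→ℚ-+ (suc a) k) (cong (_+ ℕ→ℚ k) (ℕ→ℚ-suc a))))
             (solve 3 (λ x a k → con 1ℚ :+ (con 1ℚ :+ a :+ k) :* x :- (con 1ℚ :+ a :* x) :- x := k :* x)
               refl x (ℕ→ℚ a) (ℕ→ℚ k))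

    -- Distinct letters differ by at least x, and the fractional part x * K⁻ A / K A is at most x.
    ∷-≼-< : ∀ {a c} A B → a ℕ.< c → a ∷ A ≼ c ∷ B
    ∷-≼-< {a} {c} A B a<c = ≤-by-difference
      (0≤+ (0≤+ (0≤* (0≤* (b-< a<c) (0≤K A)) (0≤K B))
                (0≤* (0≤* 0≤x (≤⇒0≤- (K⁻≤K A))) (0≤K B)))
           (0≤* (0≤* 0≤x (0≤K⁻ B)) (0≤K A)))
      (solve 7 (λ x ba bc a a⁻ b b⁻ → (bc :- ba :- x) :* a :* b :+ x :* (a :- a⁻) :* b :+ x :* b⁻ :* a
                                   := (bc :* b :+ x :* b⁻) :* a :- (ba :* a :+ x :* a⁻) :* b)
        refl x (b a) (b c) (K A) (K⁻ A) (K B) (K⁻ B))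

    -- After an equal first letter the tails enter as `x` divided by their continued fractions,
    -- which reverses the order.
    ∷-≼-≡ : ∀ a A B → B ≼ A → a ∷ A ≼ a ∷ B
    ∷-≼-≡ a A B B≼A = ≤-by-difference (0≤* 0≤x (≤⇒0≤- B≼A))
      (solve 6 (λ x c a a⁻ b b⁻ → x :* (a :* b⁻ :- b :* a⁻)
                               := (c :* b :+ x :* b⁻) :* a :- (c :* a :+ x :* a⁻) :* b)
        refl x (b a) (K A) (K⁻ A) (K B) (K⁻ B))

    -- The continued fraction of `[]` is 1/0, so the empty word is the greatest.
    ≼-[] : ∀ A → A ≼ []
    ≼-[] A = ≤-by-difference (0≤K⁻ A)
      (solve 2 (λ a a⁻ → a⁻ := con 1ℚ :* a⁻ :- a :* con 0ℚ) refl (K A) (K⁻ A))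

    K-cancel : ∀ S {p q} → K S * p ≤ K S * q → p ≤ q
    K-cancel S = *-cancelˡ-≤-pos (K S) {{positive (<-≤-trans (positive⁻¹ 1ℚ) (1≤K S))}}

    -- The old value minus the new one is `x * (K⁻ S - β S) * (K Q * K⁻ P - K P * K⁻
    -- Q)`. Since `S` and its reversal have the same `K`, comparing them amounts to comparing `β
    -- S` with `K⁻ S`.
    Φ-reverse-≼ : ∀ P S Q → S ≼ reverse S → P ≼ Q → Φ P (reverse S ++ Q) ≤ Φ P (S ++ Q)
    Φ-reverse-≼ P S Q S≼ P≼Q = subst₂ _≤_ (sym (Φ-reverse-++ P S Q)) (sym (Φ-++ P S Q))
      (≤-by-difference (0≤* (0≤* 0≤x (≤⇒0≤- β≤K⁻)) (≤⇒0≤- P≼Q))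
        (solve 9 (λ x p p⁻ s s⁻ β δ q q⁻ → x :* (s⁻ :- β) :* (q :* p⁻ :- p :* q⁻)
           := p :* (s :* q :+ x :* β :* q⁻) :+ x :* (p⁻ :* (s⁻ :* q :+ δ :* q⁻))
           :- (p :* (s :* q :+ x :* s⁻ :* q⁻) :+ x :* (p⁻ :* (β :* q :+ δ :* q⁻))))
          refl x (K P) (K⁻ P) (K S) (K⁻ S) (β S) (δ S) (K Q) (K⁻ Q)))
      where
      β≤K⁻ : β S ≤ K⁻ S
      β≤K⁻ = K-cancel S (subst₂ (λ k l → K S * k ≤ l * K⁻ S) (K⁻-reverse S) (K-reverse S) S≼)

    Φ-reverse-≽ : ∀ P S Q → reverse S ≼ S → Q ≼ P → Φ P (reverse S ++ Q) ≤ Φ P (S ++ Q)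
    Φ-reverse-≽ P S Q ≼S Q≼P = subst₂ _≤_ (sym (Φ-reverse-++ P S Q)) (sym (Φ-++ P S Q))
      (≤-by-difference (0≤* (0≤* 0≤x (≤⇒0≤- K⁻≤β)) (≤⇒0≤- Q≼P))
        (solve 9 (λ x p p⁻ s s⁻ β δ q q⁻ → x :* (β :- s⁻) :* (p :* q⁻ :- q :* p⁻)
           := p :* (s :* q :+ x :* β :* q⁻) :+ x :* (p⁻ :* (s⁻ :* q :+ δ :* q⁻))
           :- (p :* (s :* q :+ x :* s⁻ :* q⁻) :+ x :* (p⁻ :* (β :* q :+ δ :* q⁻))))
          refl x (K P) (K⁻ P) (K S) (K⁻ S) (β S) (δ S) (K Q) (K⁻ Q)))
      where
      K⁻≤β : K⁻ S ≤ β S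
      K⁻≤β = K-cancel S (subst₂ (λ k l → k * K⁻ S ≤ K S * l) (K-reverse S) (K⁻-reverse S) ≼S)

-- Zigzag arrangements

AllPairs-reverse : ∀ {A : Set} {R : A → A → Set} {xs} →
                   AllPairs R xs → AllPairs (λ a c → R c a) (reverse xs)
AllPairs-reverse []                     = []
AllPairs-reverse {R = R} {x ∷ xs} (px ∷ pxs) = subst (AllPairs _) (sym (unfold-reverse x xs))
  (AllPairsₚ.++⁺ (AllPairs-reverse pxs) ([] ∷ [])
    (All.map (_∷ []) (All-resp-↭ (↭-sym (↭-reverse xs)) px)))

-- The reversal makes the next pair of ends come from the opposite extreme of D.
data Zigzag : List ℕ → List ℕ → Set where
  empty  : Zigzag [] []
  single : ∀ d → Zigzag [ d ] [ d ]
  outer  : ∀ {c d D e} → Zigzag (reverse D) e → Zigzag (c ∷ d ∷ D) (c ∷ e ++ [ d ])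

-- The flag is the current direction: with `true` the largest remaining letter is the extreme one,
-- with `false` the smallest. It lets one induction treat both.
Before : Bool → ℕ → ℕ → Set
Before true  a c = a ℕ.< c
Before false a c = c ℕ.< a

Beforeᵉ : Bool → ℕ → ℕ → Set
Beforeᵉ f a c = a ≡ c ⊎ Before f a c

Beforeᵉ-not : ∀ f {a c} → Beforeᵉ f a c → Beforeᵉ (not f) c a
Beforeᵉ-not f     (inj₁ refl) = inj₁ refl
Beforeᵉ-not true  (inj₂ a<c)  = inj₂ a<c
Beforeᵉ-not false (inj₂ c<a)  = inj₂ c<a

module Greedy (x : ℚ) (0<x : 0ℚ < x) where
  open Continuant x

  Below : Bool → List ℕ → List ℕ → Set
  Below true  A B = A ≼ B
  Below false A B = B ≼ A

  Below-Before : ∀ f {a c} A B → Before f a c → Below f (a ∷ A) (c ∷ B)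
  Below-Before true  A B a<c = ∷-≼-< 0<x A B a<c
  Below-Before false A B c<a = ∷-≼-< 0<x B A c<a

  Below-∷ : ∀ f a A B → Below f A B → Below (not f) (a ∷ A) (a ∷ B)
  Below-∷ true  a A B A≼B = ∷-≼-≡ 0<x a B A A≼B
  Below-∷ false a A B B≼A = ∷-≼-≡ 0<x a A B B≼A

  -- One step of the alternating-lexicographic order: a strict difference of first letters decides,
  -- a tie passes to the tails with the direction switched.
  Below-Beforeᵉ : ∀ f {a c} A B → Beforeᵉ (not f) a c → Below f A B → Below (not f) (a ∷ A) (c ∷ B)
  Below-Beforeᵉ f A B (inj₁ refl) A≤B = Below-∷ f _ A B A≤B
  Below-Beforeᵉ f A B (inj₂ a<c)  _   = Below-Before (not f) A B a<c

  Φ-reverse : ∀ f P S Q → Below f S (reverse S) → Below f P Q → Φ P (reverse S ++ Q) ≤ Φ P (S ++ Q)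
  Φ-reverse true  = Φ-reverse-≼ 0<x
  Φ-reverse false = Φ-reverse-≽ 0<x

  -- Reverse the prefix of `w` that ends with the extreme letter `d`. Prefix and reversal start with
  -- `s` and `d`, so they are comparable at the first letter; if `s` equals `d` nothing has to move.
  -- The surroundings are `P` and `T ++ Q`, where `T` is the untouched rest of `w`, which explains
  -- the quantified hypothesis.
  extreme-first : ∀ f P Q d w → All (λ a → Beforeᵉ f a d) w → d ∈ w →
    (∀ T → All (_∈ w) T → Below f P (T ++ Q)) →
    ∃[ w' ] (d ∷ w' ↭ w × Φ P (d ∷ w' ++ Q) ≤ Φ P (w ++ Q))
  extreme-first f P Q d w w≤d d∈w P≤ with ∈-∃++ d∈w
  ... | []    , T , refl = T , ↭-refl , ≤-refl
  ... | s ∷ S , T , refl with All.head w≤d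
  ...   | inj₁ refl = S ++ d ∷ T , ↭-refl , ≤-refl
  ...   | inj₂ s<d  = reverse (s ∷ S) ++ T , perm , le
    where
    S' = s ∷ S ++ [ d ]
    reverse-S' : reverse S' ≡ d ∷ reverse (s ∷ S)
    reverse-S' = reverse-++ (s ∷ S) [ d ]
    perm : d ∷ reverse (s ∷ S) ++ T ↭ s ∷ S ++ d ∷ T
    perm = ↭-trans (↭-prep d (++⁺ʳ T (↭-reverse (s ∷ S)))) (↭-sym (shift d (s ∷ S) T))
    S'≤ : Below f S' (reverse S')
    S'≤ = subst (Below f S') (sym reverse-S') (Below-Before f _ _ s<d)
    le : Φ P (d ∷ (reverse (s ∷ S) ++ T) ++ Q) ≤ Φ P ((s ∷ S ++ d ∷ T) ++ Q)
    le = subst₂ (λ u v → Φ P u ≤ Φ P v)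
      (trans (cong (_++ (T ++ Q)) reverse-S') (cong (d ∷_) (sym (++-assoc (reverse (s ∷ S)) T Q))))
      (cong (s ∷_) (trans (++-assoc S [ d ] (T ++ Q)) (sym (++-assoc S (d ∷ T) Q))))
      (Φ-reverse f P S' (T ++ Q) S'≤
        (P≤ T (All.tabulate (λ t∈T → ∈-++⁺ʳ (s ∷ S) (there t∈T)))))

  -- `P` and `Q` are the finished ends, both read from the gap outwards. The two hypotheses differ
  -- because the left end is served first: when a letter is brought to the right end, the opposite
  -- side already contains the new letter of the left end, so `Q` is compared only with words having
  -- at least one letter before `P`. Without that letter the invariant would not survive, as `c` on
  -- the left is at least as extreme as `d` on the right.
  zigzag-minimal : ∀ f P Q {D e} w → Zigzag D e → AllPairs (λ a c → Beforeᵉ f c a) D → w ↭ D →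
    (∀ T → All (_∈ D) T → Below f P (T ++ Q)) →
    (∀ T t → All (_∈ D) (t ∷ T) → Below f Q (T ++ t ∷ P)) →
    Φ P (e ++ Q) ≤ Φ P (w ++ Q)
  zigzag-minimal f P Q w empty      _ w↭ _ _ with refl ← ↭-empty-inv w↭ = ≤-refl
  zigzag-minimal f P Q w (single d) _ w↭ _ _ with refl ← ↭-singleton-inv w↭ = ≤-refl
  zigzag-minimal f P Q w (outer {c} {d} {D} {e} z) ((d≤c ∷ D≤c) ∷ D≤d ∷ sorted) w↭ P≤ Q≤
    with extreme-first f P Q c w
           (All-resp-↭ (↭-sym w↭) (inj₁ refl ∷ d≤c ∷ D≤c))
           (∈-resp-↭ (↭-sym w↭) (here refl))
           (λ T T∈ → P≤ T (All.map (∈-resp-↭ w↭) T∈))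
  ... | w₁ , cw₁↭w , le₁
    with drop-∷ (↭-trans cw₁↭w w↭)
  ... | w₁↭
    with extreme-first f Q (c ∷ P) d (reverse w₁)
           (All-resp-↭ (↭-sym (↭-trans (↭-reverse w₁) w₁↭)) (inj₁ refl ∷ D≤d))
           (∈-resp-↭ (↭-sym (↭-trans (↭-reverse w₁) w₁↭)) (here refl))
           -- The letter `c` just placed on the left is the one that must precede `P`.
           (λ T T∈ → Q≤ T c (here refl ∷ All.map (there ∘ ∈-resp-↭ (↭-trans (↭-reverse w₁) w₁↭)) T∈))
  ... | w₂ , dw₂↭ , le₂ = begin
    Φ P ((c ∷ e ++ [ d ]) ++ Q)    ≡⟨ cong (λ u → Φ P (c ∷ u)) (++-assoc e [ d ] Q) ⟩
    Φ P (c ∷ e ++ d ∷ Q)           ≡⟨ sym (Φ-shift c P (e ++ d ∷ Q)) ⟩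
    Φ (c ∷ P) (e ++ d ∷ Q)         ≤⟨ zigzag-minimal (not f) (c ∷ P) (d ∷ Q) (reverse w₂) z
                                        (AllPairs.map (Beforeᵉ-not f) (AllPairs-reverse sorted))
                                        (↭-trans (↭-reverse w₂) (↭-trans w₂↭D (↭-sym (↭-reverse D)))) P≤' Q≤' ⟩
    Φ (c ∷ P) (reverse w₂ ++ d ∷ Q) ≡⟨ sym (Φ-flip w₂ (d ∷ Q) (c ∷ P)) ⟩
    Φ (d ∷ Q) (w₂ ++ c ∷ P)        ≡⟨ Φ-shift d Q (w₂ ++ c ∷ P) ⟩
    Φ Q (d ∷ w₂ ++ c ∷ P)          ≤⟨ le₂ ⟩
    Φ Q (reverse w₁ ++ c ∷ P)      ≡⟨ sym (Φ-flip w₁ (c ∷ P) Q) ⟩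
    Φ (c ∷ P) (w₁ ++ Q)            ≡⟨ Φ-shift c P (w₁ ++ Q) ⟩
    Φ P (c ∷ w₁ ++ Q)              ≤⟨ le₁ ⟩
    Φ P (w ++ Q)                   ∎
    where
    open ≤-Reasoning
    w₂↭D : w₂ ↭ D
    w₂↭D = drop-∷ (↭-trans dw₂↭ (↭-trans (↭-reverse w₁) w₁↭))
    ∈D : ∀ {a} → a ∈ reverse D → a ∈ D
    ∈D = ∈-resp-↭ (↭-reverse D)
    -- The new first letter `c` beats each letter left, and also `d` when nothing is left between;
    -- ties fall back on the old invariant, with `d` appended to the completion.
    P≤' : ∀ T → All (_∈ reverse D) T → Below (not f) (c ∷ P) (T ++ d ∷ Q)
    P≤' []      []       = Below-Beforeᵉ f P Q (Beforeᵉ-not f d≤c) (P≤ [] [])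
    P≤' (t ∷ T) (t∈ ∷ T∈) = Below-Beforeᵉ f P (T ++ d ∷ Q)
      (Beforeᵉ-not f (All.lookup D≤c (∈D t∈)))
      (subst (Below f P) (++-assoc T [ d ] Q)
        (P≤ (T ++ [ d ]) (Allₚ.++⁺ (All.map (there ∘ there ∘ ∈D) T∈) (there (here refl) ∷ []))))
    -- Here a tie falls back on the old invariant for `Q`, with `c` as the letter before `P`.
    Q≤' : ∀ T t → All (_∈ reverse D) (t ∷ T) → Below (not f) (d ∷ Q) (T ++ t ∷ c ∷ P)
    Q≤' []       t (t∈ ∷ []) = Below-Beforeᵉ f Q (c ∷ P)
      (Beforeᵉ-not f (All.lookup D≤d (∈D t∈))) (Q≤ [] c (here refl ∷ []))
    Q≤' (t' ∷ T) t (t∈ ∷ t'∈ ∷ T∈) = Below-Beforeᵉ f Q (T ++ t ∷ c ∷ P)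
      (Beforeᵉ-not f (All.lookup D≤d (∈D t'∈)))
      (subst (Below f Q) (++-assoc T [ t ] (c ∷ P))
        (Q≤ (T ++ [ t ]) c (here refl ∷ Allₚ.++⁺ (All.map (there ∘ there ∘ ∈D) T∈) (there (there (∈D t∈)) ∷ []))))

  -- The end letters 0 stand for the two leaves that prolong the spine.
  zigzag-minimal-0 : ∀ {D e} w → Zigzag D e → AllPairs (λ a c → c ℕ.≤ a) D → w ↭ D →
    K (0 ∷ e ++ [ 0 ]) ≤ K (0 ∷ w ++ [ 0 ])
  zigzag-minimal-0 {D} {e} w z sorted w↭ = subst₂ _≤_ (K-0 e) (K-0 w)
    (zigzag-minimal true [ 0 ] [ 0 ] w z (AllPairs.map ≤⇒Beforeᵉ sorted) w↭
      (λ T _ → [0]≼ T) (λ T t _ → subst ([ 0 ] ≼_) (++-assoc T [ t ] [ 0 ]) ([0]≼ (T ++ [ t ]))))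
    where
    ≤⇒Beforeᵉ : ∀ {a c} → c ℕ.≤ a → Beforeᵉ true c a
    ≤⇒Beforeᵉ c≤a with ℕₚ.m≤n⇒m<n∨m≡n c≤a
    ... | inj₁ c<a = inj₂ c<a
    ... | inj₂ c≡a = inj₁ c≡a
    -- The letter 0 is the least one, and on a tie the tails to be compared are `[]`, of infinite
    -- value, and `T ++ [ 0 ]`.
    [0]≼ : ∀ T → [ 0 ] ≼ T ++ [ 0 ]
    [0]≼ []          = ≤-refl
    [0]≼ (zero ∷ T)  = ∷-≼-≡ 0<x 0 [] (T ++ [ 0 ]) (≼-[] 0<x (T ++ [ 0 ]))
    [0]≼ (suc t ∷ T) = ∷-≼-< 0<x {0} {suc t} [] (T ++ [ 0 ]) (ℕ.s≤s ℕ.z≤n)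
    K-0 : ∀ u → Φ [ 0 ] (u ++ [ 0 ]) ≡ K (0 ∷ u ++ [ 0 ])
    K-0 u = trans (Φ-shift 0 [] (u ++ [ 0 ])) (K-Φ (0 ∷ u ++ [ 0 ]))

-- Matching polynomials

Σℚ : ∀ {A : Set} → (A → ℚ) → List A → ℚ
Σℚ g L = sumℚ (map g L)

Σℚ-cong : ∀ {A : Set} {g h : A → ℚ} L → (∀ {a} → a ∈ L → g a ≡ h a) → Σℚ g L ≡ Σℚ h L
Σℚ-cong []      g≡h = refl
Σℚ-cong (a ∷ L) g≡h = cong₂ _+_ (g≡h (here refl)) (Σℚ-cong L (g≡h ∘ there))

Σℚ-+ : ∀ {A : Set} (g h : A → ℚ) L → Σℚ (λ a → g a + h a) L ≡ Σℚ g L + Σℚ h L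
Σℚ-+ g h []      = refl
Σℚ-+ g h (a ∷ L) = trans (cong (g a + h a +_) (Σℚ-+ g h L))
  (solve 4 (λ g h s t → g :+ h :+ (s :+ t) := (g :+ s) :+ (h :+ t)) refl (g a) (h a) (Σℚ g L) (Σℚ h L))

Σℚ-* : ∀ {A : Set} c (g : A → ℚ) L → Σℚ (λ a → c * g a) L ≡ c * Σℚ g L
Σℚ-* c g []      = sym (*-zeroʳ c)
Σℚ-* c g (a ∷ L) = trans (cong (c * g a +_) (Σℚ-* c g L)) (sym (*-distribˡ-+ c (g a) (Σℚ g L)))

Σℚ-*ʳ : ∀ {A : Set} c (g : A → ℚ) L → Σℚ (λ a → g a * c) L ≡ Σℚ g L * c
Σℚ-*ʳ c g []      = sym (*-zeroˡ c)
Σℚ-*ʳ c g (a ∷ L) = trans (cong (g a * c +_) (Σℚ-*ʳ c g L))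
  (solve 3 (λ c g s → g :* c :+ s :* c := (g :+ s) :* c) refl c (g a) (Σℚ g L))

Σℚ-0 : ∀ {A : Set} {g : A → ℚ} (L : List A) → (∀ {a} → a ∈ L → g a ≡ 0ℚ) → Σℚ g L ≡ 0ℚ
Σℚ-0 []      g≡0 = refl
Σℚ-0 (a ∷ L) g≡0 = cong₂ _+_ (g≡0 (here refl)) (Σℚ-0 L (g≡0 ∘ there))

Σℚ-++ : ∀ {A : Set} (g : A → ℚ) L L' → Σℚ g (L ++ L') ≡ Σℚ g L + Σℚ g L'
Σℚ-++ g []      L' = sym (+-identityˡ _)
Σℚ-++ g (a ∷ L) L' = trans (cong (g a +_) (Σℚ-++ g L L')) (sym (+-assoc (g a) (Σℚ g L) (Σℚ g L')))

Σℚ-map : ∀ {A B : Set} (g : B → ℚ) (f : A → B) L → Σℚ g (map f L) ≡ Σℚ (g ∘ f) L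
Σℚ-map g f []      = refl
Σℚ-map g f (a ∷ L) = cong (g (f a) +_) (Σℚ-map g f L)

⟦_⟧ : Bool → ℚ
⟦ t ⟧ = if t then 1ℚ else 0ℚ

if-false : ∀ {t} {p : ℚ} → t ≡ false → (if t then p else 0ℚ) ≡ 0ℚ
if-false refl = refl

if-true : ∀ {t} {p : ℚ} → t ≡ true → (if t then p else 0ℚ) ≡ p
if-true refl = refl

Σℚ-only : ∀ {P : ℕ → Set} (P? : ∀ k → Dec (P k)) (g : ℕ → ℚ) {l} L → Unique L → l ∈ L → P l → (∀ {k} → P k → l ≡ k) →
          Σℚ (λ k → if does (P? k) then g k else 0ℚ) L ≡ g l
Σℚ-only P? g (a ∷ L) (a∉ ∷ _) (here refl) Pl only rewrite dec-true (P? a) Pl =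
  trans (cong (g a +_) (Σℚ-0 L λ {k} k∈L →
    if-false (dec-false (P? k) λ Pk → All.lookup a∉ k∈L (only Pk)))) (+-identityʳ (g a))
Σℚ-only P? g (a ∷ L) (a∉ ∷ u) (there l∈L) Pl only rewrite dec-false (P? a) (λ Pa → All.lookup a∉ l∈L (sym (only Pa))) =
  trans (+-identityˡ _) (Σℚ-only P? g L u l∈L Pl only)

-- Incidence and disjointness of edges

Inc : ℕ → Edge → Set
Inc v e = proj₁ e ≡ v ⊎ proj₂ e ≡ v

inc? : ∀ v e → Dec (Inc v e)
inc? v e = (proj₁ e ℕₚ.≟ v) ⊎-dec (proj₂ e ℕₚ.≟ v)

Disjoint-sym : ∀ {e f} → Disjoint e f → Disjoint f e
Disjoint-sym (ac , ad , bc , bd) = ac ∘ sym , bc ∘ sym , ad ∘ sym , bd ∘ sym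

Disjoint-Inc : ∀ {e f} → Disjoint e f ⇔ (¬ Inc (proj₁ e) f × ¬ Inc (proj₂ e) f)
Disjoint-Inc = mk⇔
  (λ (ac , ad , bc , bd) → [ ac ∘ sym , ad ∘ sym ]′ , [ bc ∘ sym , bd ∘ sym ]′)
  (λ (a , b) → a ∘ inj₁ ∘ sym , a ∘ inj₂ ∘ sym , b ∘ inj₁ ∘ sym , b ∘ inj₂ ∘ sym)

Inc-Disjoint : ∀ {v e f} → Inc v e → Inc v f → ¬ Disjoint e f
Inc-Disjoint (inj₁ refl) vf = λ ef → proj₁ (Equivalence.to Disjoint-Inc ef) vf
Inc-Disjoint (inj₂ refl) vf = λ ef → proj₂ (Equivalence.to Disjoint-Inc ef) vf

-- Kept opaque so that these Booleans remain atoms when goals are rewritten or split into cases.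
opaque
  inc : ℕ → Edge → Bool
  inc v e = does (inc? v e)

  disj : Edge → Edge → Bool
  disj e f = does (disjoint? e f)

  inc-does : ∀ v e → inc v e ≡ does (inc? v e)
  inc-does v e = refl

  disj-does : ∀ e f → disj e f ≡ does (disjoint? e f)
  disj-does e f = refl

inc-true : ∀ {v e} → Inc v e → inc v e ≡ true
inc-true {v} {e} ve = trans (inc-does v e) (dec-true (inc? v e) ve)

inc-false : ∀ {v e} → ¬ Inc v e → inc v e ≡ false
inc-false {v} {e} ¬ve = trans (inc-does v e) (dec-false (inc? v e) ¬ve)

inc-cases : ∀ v e → (Inc v e × inc v e ≡ true) ⊎ (¬ Inc v e × inc v e ≡ false)
inc-cases v e with inc? v e
... | yes ve = inj₁ (ve , inc-true ve)
... | no ¬ve = inj₂ (¬ve , inc-false ¬ve)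

disj-inc : ∀ e f → disj e f ≡ not (inc (proj₁ e) f) ∧ not (inc (proj₂ e) f)
disj-inc e f = begin
  disj e f                ≡⟨ disj-does e f ⟩
  does (disjoint? e f)    ≡⟨ does-⇔ Disjoint-Inc (disjoint? e f) (¬? (inc? (proj₁ e) f) ×-dec ¬? (inc? (proj₂ e) f)) ⟩
  not (does (inc? (proj₁ e) f)) ∧ not (does (inc? (proj₂ e) f))
    ≡⟨ sym (cong₂ (λ p q → not p ∧ not q) (inc-does (proj₁ e) f) (inc-does (proj₂ e) f)) ⟩
  not (inc (proj₁ e) f) ∧ not (inc (proj₂ e) f) ∎
  where open ≡-Reasoning

disj-comm : ∀ e f → disj e f ≡ disj f e
disj-comm e f = trans (disj-does e f)
  (trans (does-⇔ (mk⇔ Disjoint-sym Disjoint-sym) (disjoint? e f) (disjoint? f e)) (sym (disj-does f e)))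

shared-endpoint : ∀ {v e f} → Inc v e → Inc v f → disj e f ≡ false
shared-endpoint {v} {e} {f} ve vf = trans (disj-does e f) (dec-false (disjoint? e f) (Inc-Disjoint ve vf))

-- Deletions act on a predicate and leave the edge list untouched, so two deletion histories can be
-- compared edge by edge.
EdgeSet : Set
EdgeSet = Edge → Bool

infixl 6 _∩_ _∖_
_∩_ : EdgeSet → Edge → EdgeSet
(A ∩ e) f = A f ∧ disj e f

_∖_ : EdgeSet → ℕ → EdgeSet
(A ∖ v) f = A f ∧ not (inc v f)

∧-swapʳ : ∀ p q r → (p ∧ q) ∧ r ≡ (p ∧ r) ∧ q
∧-swapʳ p q r = trans (∧-assoc p q r) (trans (cong (p ∧_) (∧-comm q r)) (sym (∧-assoc p r q)))

module Matching (x : ℚ) where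

  -- The matching polynomial of E restricted to the edges in A.
  W : EdgeSet → List Edge → ℚ
  W A []      = 1ℚ
  W A (e ∷ E) = W A E + (if A e then x * W (A ∩ e) E else 0ℚ)

  W-cong : ∀ {A B} E → (∀ {e} → e ∈ E → A e ≡ B e) → W A E ≡ W B E
  W-cong []      A≡B = refl
  W-cong {A} {B} (e ∷ E) A≡B rewrite A≡B (here refl) =
    cong₂ (λ p q → p + (if B e then x * q else 0ℚ)) (W-cong E (A≡B ∘ there))
      (W-cong E (λ f∈E → cong (_∧ _) (A≡B (there f∈E))))

  W-none : ∀ {A} E → (∀ {e} → e ∈ E → A e ≡ false) → W A E ≡ 1ℚ
  W-none []      none = refl
  W-none (e ∷ E) none rewrite none (here refl) = trans (+-identityʳ _) (W-none E (none ∘ there))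

  -- The share of the matchings that cover `v` by the edge `f`, with the factor `x` of `f` left out.
  at : EdgeSet → ℕ → List Edge → Edge → ℚ
  at A v E f = if inc v f ∧ A f then W (A ∩ f) E else 0ℚ

  private
    at-dead : ∀ A v e E f → (Inc v f → (A ∩ f) e ≡ false) → at A v (e ∷ E) f ≡ at A v E f
    at-dead A v e E f dead with inc-cases v f
    ... | inj₂ (_ , eq) rewrite eq = refl
    ... | inj₁ (vf , eq) rewrite eq with A f
    ...   | false = refl
    ...   | true rewrite dead vf = +-identityʳ _

    at-alive : ∀ A v e E f → A e ≡ true → at A v (e ∷ E) f ≡ at A v E f + x * at (A ∩ e) v E f
    at-alive A v e E f Ae with inc v f
    ... | false = sym (trans (cong (0ℚ +_) (*-zeroʳ x)) (+-identityʳ 0ℚ))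
    ... | true with A f
    ...   | false = sym (trans (cong (0ℚ +_) (*-zeroʳ x)) (+-identityʳ 0ℚ))
    ...   | true rewrite Ae | disj-comm f e with disj e f
    ...     | false = cong (W (A ∩ f) E +_) (sym (*-zeroʳ x))
    ...     | true  = cong (λ z → W (A ∩ f) E + x * z)
                       (W-cong E λ {g} _ → ∧-swapʳ (A g) (disj f g) (disj e g))

  private
    W-dead : ∀ A e E → A e ≡ false → W A (e ∷ E) ≡ W A E
    W-dead A e E Ae = trans (cong (W A E +_) (if-false Ae)) (+-identityʳ (W A E))

    W-alive : ∀ A e E → A e ≡ true → W A (e ∷ E) ≡ W A E + x * W (A ∩ e) E
    W-alive A e E Ae = cong (W A E +_) (if-true Ae)

    Bool-cases : ∀ t → t ≡ true ⊎ t ≡ false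
    Bool-cases true  = inj₁ refl
    Bool-cases false = inj₂ refl

  -- A matching either misses `v` or covers it by exactly one edge at `v`. In the induction a head
  -- edge at `v` supplies a new summand and is excluded from all the others; a head edge away from
  -- `v` needs the recurrence twice, with and without that edge.
  W-vertex : ∀ A v E → W A E ≡ W (A ∖ v) E + x * Σℚ (at A v E) E
  W-vertex A v []      = sym (trans (cong (1ℚ +_) (*-zeroʳ x)) (+-identityʳ 1ℚ))
  W-vertex A v (e ∷ E) with Bool-cases (A e) | inc-cases v e
  ... | inj₂ Ae | _ = begin
    W A (e ∷ E)                               ≡⟨ W-dead A e E Ae ⟩
    W A E                                     ≡⟨ W-vertex A v E ⟩
    W (A ∖ v) E + x * Σℚ (at A v E) E
      ≡⟨ cong (λ s → W (A ∖ v) E + x * s) (sym (+-identityˡ _)) ⟩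
    W (A ∖ v) E + x * (0ℚ + Σℚ (at A v E) E)
      ≡⟨ cong₂ (λ w s → w + x * s) (sym (W-dead (A ∖ v) e E (cong (_∧ not (inc v e)) Ae)))
           (sym (cong₂ _+_ (if-false (trans (cong (inc v e ∧_) Ae) (∧-zeroʳ (inc v e))))
             (Σℚ-cong E λ {f} _ → at-dead A v e E f λ _ → cong (_∧ disj f e) Ae))) ⟩
    W (A ∖ v) (e ∷ E) + x * Σℚ (at A v (e ∷ E)) (e ∷ E) ∎
    where open ≡-Reasoning
  ... | inj₁ Ae | inj₁ (ve , eq) = begin
    W A (e ∷ E)                               ≡⟨ W-alive A e E Ae ⟩
    W A E + x * W (A ∩ e) E                   ≡⟨ cong (_+ x * W (A ∩ e) E) (W-vertex A v E) ⟩
    W (A ∖ v) E + x * Σℚ (at A v E) E + x * W (A ∩ e) E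
      ≡⟨ solve 4 (λ x w s t → w :+ x :* s :+ x :* t := w :+ x :* (t :+ s)) refl x (W (A ∖ v) E) (Σℚ (at A v E) E) (W (A ∩ e) E) ⟩
    W (A ∖ v) E + x * (W (A ∩ e) E + Σℚ (at A v E) E)
      ≡⟨ cong₂ (λ w s → w + x * s)
           (sym (W-dead (A ∖ v) e E (trans (cong (A e ∧_) (cong not eq)) (∧-zeroʳ (A e)))))
           (sym (cong₂ _+_
             (trans (if-true (cong₂ _∧_ eq Ae))
               (W-dead (A ∩ e) e E (trans (cong (A e ∧_) (shared-endpoint ve ve)) (∧-zeroʳ (A e)))))
             (Σℚ-cong E λ {f} _ → at-dead A v e E f λ vf →
               trans (cong (A e ∧_) (shared-endpoint vf ve)) (∧-zeroʳ (A e))))) ⟩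
    W (A ∖ v) (e ∷ E) + x * Σℚ (at A v (e ∷ E)) (e ∷ E) ∎
    where open ≡-Reasoning
  ... | inj₁ Ae | inj₂ (_ , eq) = begin
    W A (e ∷ E)                               ≡⟨ W-alive A e E Ae ⟩
    W A E + x * W (A ∩ e) E
      ≡⟨ cong₂ (λ p q → p + x * q) (W-vertex A v E) (W-vertex (A ∩ e) v E) ⟩
    W (A ∖ v) E + x * Σℚ (at A v E) E + x * (W (A ∩ e ∖ v) E + x * Σℚ (at (A ∩ e) v E) E)
      ≡⟨ solve 5 (λ x w s u t → w :+ x :* s :+ x :* (u :+ x :* t) := w :+ x :* u :+ x :* (con 0ℚ :+ (s :+ x :* t)))
           refl x (W (A ∖ v) E) (Σℚ (at A v E) E) (W (A ∩ e ∖ v) E) (Σℚ (at (A ∩ e) v E) E) ⟩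
    W (A ∖ v) E + x * W (A ∩ e ∖ v) E + x * (0ℚ + (Σℚ (at A v E) E + x * Σℚ (at (A ∩ e) v E) E))
      ≡⟨ cong₂ (λ w s → w + x * s)
           (sym (trans (W-alive (A ∖ v) e E (cong₂ _∧_ Ae (cong not eq)))
             (cong (λ u → W (A ∖ v) E + x * u) (W-cong E λ {g} _ → ∧-swapʳ (A g) (not (inc v g)) (disj e g)))))
           (sym (cong₂ _+_ (if-false (cong (_∧ A e) eq))
             (trans (Σℚ-cong E λ {f} _ → at-alive A v e E f Ae)
               (trans (Σℚ-+ (at A v E) (λ f → x * at (A ∩ e) v E f) E)
                 (cong (Σℚ (at A v E) E +_) (Σℚ-* x (at (A ∩ e) v E) E)))))) ⟩
    W (A ∖ v) (e ∷ E) + x * Σℚ (at A v (e ∷ E)) (e ∷ E) ∎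
    where open ≡-Reasoning

  -- `W` unfolded over a single sublist: the power of `x` if `S` is a matching inside `A`, otherwise
  -- 0. It mediates between counting matchings by size and the edge recurrence.
  weight : EdgeSet → List Edge → ℚ
  weight A []      = 1ℚ
  weight A (e ∷ S) = if A e then x * weight (A ∩ e) S else 0ℚ

  weight-power : ∀ (A : EdgeSet) S → All (λ e → A e ≡ true) S →
                 weight A S ≡ (if does (allPairs? disjoint? S) then x ^ℚ length S else 0ℚ)
  weight-power A []      []       = refl
  weight-power A (e ∷ S) (Ae ∷ AS) rewrite Ae with all? (disjoint? e) S
  ... | yes dS rewrite weight-power (A ∩ e) S
                  (All.zipWith (λ (p , q) → cong₂ _∧_ p (trans (disj-does e _) (dec-true (disjoint? e _) q))) (AS , dS))
      with does (allPairs? disjoint? S)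
  ...   | true  = refl
  ...   | false = *-zeroʳ x
  weight-power A (e ∷ S) (Ae ∷ AS) | no ¬dS = trans (cong (x *_) (none S ¬dS)) (*-zeroʳ x)
    where
    -- The edge that meets `e` may come late in `S`, so the restriction by `e` is commuted past the
    -- edges before it.
    none : ∀ S {B} → ¬ All (Disjoint e) S → weight (B ∩ e) S ≡ 0ℚ
    none []      ¬dS = contradiction [] ¬dS
    none (f ∷ S) {B} ¬dS with disjoint? e f
    ... | no  ¬ef rewrite trans (disj-does e f) (dec-false (disjoint? e f) ¬ef) | ∧-zeroʳ (B f) = refl
    ... | yes ef  = go (B f ∧ disj e f)
      where
      go : ∀ t → (if t then x * weight (B ∩ e ∩ f) S else 0ℚ) ≡ 0ℚ
      go false = refl
      go true  = trans (cong (x *_) (trans (weight-cong S (λ g → ∧-swapʳ (B g) (disj e g) (disj f g)))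
                   (none S {B ∩ f} (λ dS → ¬dS (ef ∷ dS))))) (*-zeroʳ x)
        where
        weight-cong : ∀ {A B : EdgeSet} S → (∀ e → A e ≡ B e) → weight A S ≡ weight B S
        weight-cong []      A≡B = refl
        weight-cong {A} {B} (e ∷ S) A≡B rewrite A≡B e =
          cong (λ q → if B e then x * q else 0ℚ) (weight-cong S (λ f → cong (_∧ _) (A≡B f)))

  Σ-weight : ∀ A E → Σℚ (weight A) (sublists E) ≡ W A E
  Σ-weight A []      = refl
  Σ-weight A (e ∷ E) = trans (Σℚ-++ (weight A) (sublists E) (map (e ∷_) (sublists E)))
    (cong₂ _+_ (Σ-weight A E) (trans (Σℚ-map (weight A) (e ∷_) (sublists E)) (last (A e))))
    where
    last : ∀ t → Σℚ (λ S → if t then x * weight (A ∩ e) S else 0ℚ) (sublists E) ≡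
                 (if t then x * W (A ∩ e) E else 0ℚ)
    last false = Σℚ-0 (sublists E) (λ _ → refl)
    last true  = trans (Σℚ-* x (weight (A ∩ e)) (sublists E)) (cong (x *_) (Σ-weight (A ∩ e) E))

  sublists-length : ∀ (E : List Edge) → All (λ S → length S ℕ.≤ length E) (sublists E)
  sublists-length []      = ℕ.z≤n ∷ []
  sublists-length (e ∷ E) = Allₚ.++⁺ (All.map ℕₚ.m≤n⇒m≤1+n (sublists-length E))
                                     (Allₚ.map⁺ (All.map ℕ.s≤s (sublists-length E)))

  -- Exchanges the two summations: a matching `S` contributes to the single index `length S`, which
  -- the bound `N` keeps inside the range.
  count-by-length : ∀ N (L : List (List Edge)) → All (λ S → length S ℕ.≤ N) L →
    Σℚ (λ k → ℕ→ℚ (length (filter (λ S → (length S ℕₚ.≟ k) ×-dec allPairs? disjoint? S) L)) * (x ^ℚ k)) (upTo (suc N))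
      ≡ Σℚ (weight (const true)) L
  count-by-length N []      []         = Σℚ-0 (upTo (suc N)) (λ {k} _ → *-zeroˡ (x ^ℚ k))
  count-by-length N (S ∷ L) (S≤N ∷ L≤N) = begin
    Σℚ (λ k → ℕ→ℚ (count k (S ∷ L)) * (x ^ℚ k)) (upTo (suc N))
      ≡⟨ Σℚ-cong (upTo (suc N)) (λ {k} _ → split k) ⟩
    Σℚ (λ k → (if does (sel k S) then x ^ℚ k else 0ℚ) + ℕ→ℚ (count k L) * (x ^ℚ k)) (upTo (suc N))
      ≡⟨ Σℚ-+ (λ k → if does (sel k S) then x ^ℚ k else 0ℚ) (λ k → ℕ→ℚ (count k L) * (x ^ℚ k)) (upTo (suc N)) ⟩
    Σℚ (λ k → if does (sel k S) then x ^ℚ k else 0ℚ) (upTo (suc N)) + Σℚ (λ k → ℕ→ℚ (count k L) * (x ^ℚ k)) (upTo (suc N))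
      ≡⟨ cong₂ _+_ (trans (one (allPairs? disjoint? S)) (sym (weight-power (const true) S (All.tabulate (λ _ → refl))))) (count-by-length N L L≤N) ⟩
    Σℚ (weight (const true)) (S ∷ L) ∎
    where
    open ≡-Reasoning
    sel : ∀ k S → Dec (length S ≡ k × IsMatching S)
    sel k S = (length S ℕₚ.≟ k) ×-dec allPairs? disjoint? S
    count : ℕ → List (List Edge) → ℕ
    count k L = length (filter (sel k) L)
    split : ∀ k → ℕ→ℚ (count k (S ∷ L)) * (x ^ℚ k) ≡ (if does (sel k S) then x ^ℚ k else 0ℚ) + ℕ→ℚ (count k L) * (x ^ℚ k)
    split k = by (sel k S)
      where
      by : Dec (length S ≡ k × IsMatching S) →
           ℕ→ℚ (count k (S ∷ L)) * (x ^ℚ k) ≡ (if does (sel k S) then x ^ℚ k else 0ℚ) + ℕ→ℚ (count k L) * (x ^ℚ k)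
      by (no ¬s) = trans (cong (λ L → ℕ→ℚ (length L) * (x ^ℚ k)) (filter-reject (sel k) ¬s))
        (trans (sym (+-identityˡ _)) (cong (_+ ℕ→ℚ (count k L) * (x ^ℚ k)) (sym (if-false (dec-false (sel k S) ¬s)))))
      by (yes s) = trans (cong (λ L → ℕ→ℚ (length L) * (x ^ℚ k)) (filter-accept (sel k) s))
        (trans (cong (_* (x ^ℚ k)) (ℕ→ℚ-suc (count k L)))
          (trans (solve 2 (λ c y → (con 1ℚ :+ c) :* y := y :+ c :* y) refl (ℕ→ℚ (count k L)) (x ^ℚ k))
            (cong (_+ ℕ→ℚ (count k L) * (x ^ℚ k)) (sym (if-true (dec-true (sel k S) s))))))
    one : Dec (IsMatching S) → Σℚ (λ k → if does (sel k S) then x ^ℚ k else 0ℚ) (upTo (suc N)) ≡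
          (if does (allPairs? disjoint? S) then x ^ℚ length S else 0ℚ)
    one (yes mS) = trans
      (Σℚ-only (λ k → sel k S) (x ^ℚ_) (upTo (suc N)) (Uniqueₚ.upTo⁺ (suc N)) (∈-upTo⁺ (ℕ.s≤s S≤N)) (refl , mS) proj₁)
      (sym (if-true (dec-true (allPairs? disjoint? S) mS)))
    one (no ¬mS) = trans
      (Σℚ-0 (upTo (suc N)) (λ {k} _ → if-false (dec-false (sel k S) (¬mS ∘ proj₂))))
      (sym (if-false (dec-false (allPairs? disjoint? S) ¬mS)))

  M≡W : ∀ G → M G x ≡ W (const true) (E G)
  M≡W G = trans (count-by-length (length (E G)) (sublists (E G)) (sublists-length (E G))) (Σ-weight (const true) (E G))

-- Peeling a caterpillar along its spine

same? : ∀ e f → Dec (SameEdge e f)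
same? (a , b) (c , d) = ((a ℕₚ.≟ c) ×-dec (b ℕₚ.≟ d)) ⊎-dec ((a ℕₚ.≟ d) ×-dec (b ℕₚ.≟ c))

opaque
  same : Edge → Edge → Bool
  same e f = does (same? e f)

  same-does : ∀ e f → same e f ≡ does (same? e f)
  same-does e f = refl

same-true : ∀ {e f} → SameEdge e f → same e f ≡ true
same-true {e} {f} s = trans (same-does e f) (dec-true (same? e f) s)

same-false : ∀ {e f} → ¬ SameEdge e f → same e f ≡ false
same-false {e} {f} s = trans (same-does e f) (dec-false (same? e f) s)

SameEdge⇒Incˡ : ∀ {e u v} → SameEdge e (u , v) → Inc u e
SameEdge⇒Incˡ (inj₁ (a , b)) = inj₁ a
SameEdge⇒Incˡ (inj₂ (a , b)) = inj₂ b

SameEdge⇒Incʳ : ∀ {e u v} → SameEdge e (u , v) → Inc v e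
SameEdge⇒Incʳ (inj₁ (a , b)) = inj₂ b
SameEdge⇒Incʳ (inj₂ (a , b)) = inj₁ a

SameEdge-Inc : ∀ {e u v w} → SameEdge e (u , v) → Inc w e → w ≡ u ⊎ w ≡ v
SameEdge-Inc (inj₁ (refl , refl)) (inj₁ refl) = inj₁ refl
SameEdge-Inc (inj₁ (refl , refl)) (inj₂ refl) = inj₂ refl
SameEdge-Inc (inj₂ (refl , refl)) (inj₁ refl) = inj₂ refl
SameEdge-Inc (inj₂ (refl , refl)) (inj₂ refl) = inj₁ refl

SameEdge-disj : ∀ {e u v} → SameEdge e (u , v) → ∀ f → disj e f ≡ not (inc u f) ∧ not (inc v f)
SameEdge-disj (inj₁ (refl , refl)) f = disj-inc _ f
SameEdge-disj {a , b} (inj₂ (refl , refl)) f = trans (disj-inc (a , b) f) (∧-comm (not (inc a f)) (not (inc b f)))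

split-at-unique : ∀ {v : ℕ} xs {ys} xs' {ys'} → xs ++ v ∷ ys ≡ xs' ++ v ∷ ys' → v ∉ xs → v ∉ xs' → xs ≡ xs' × ys ≡ ys'
split-at-unique []       []         refl _   _    = refl , refl
split-at-unique []       (_ ∷ xs')  refl _   v∉xs' = contradiction (here refl) v∉xs'
split-at-unique (_ ∷ xs) []         refl v∉xs _   = contradiction (here refl) v∉xs
split-at-unique (x ∷ xs) (x' ∷ xs') eq   v∉xs v∉xs'
  with refl , eq' ← ∷-injective eq
  with refl , refl ← split-at-unique xs xs' eq' (v∉xs ∘ there) (v∉xs' ∘ there) = refl , refl

Unique-resp-↭ : ∀ {xs ys : List ℕ} → xs ↭ ys → Unique xs → Unique ys
Unique-resp-↭ p = Permₛ.Unique-resp-↭ (setoid ℕ) (↭⇒↭ₛ p)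

ʳ++-↭ : ∀ (pre : List ℕ) v rest → pre ʳ++ (v ∷ rest) ↭ v ∷ pre ++ rest
ʳ++-↭ pre v rest = ↭-trans (↭-reflexive (ʳ++-defn pre))
  (↭-trans (++⁺ʳ (v ∷ rest) (↭-reverse pre)) (shift v pre rest))

Unique-++-disjoint : ∀ (xs : List ℕ) {ys w} → Unique (xs ++ ys) → w ∈ xs → w ∉ ys
Unique-++-disjoint (x ∷ xs) (x∉ ∷ u) (here refl) w∈ys = All.lookup x∉ (∈-++⁺ʳ xs w∈ys) refl
Unique-++-disjoint (x ∷ xs) (x∉ ∷ u) (there w∈)  w∈ys = Unique-++-disjoint xs u w∈ w∈ys

Unique-head : ∀ {v : ℕ} {xs} → Unique (v ∷ xs) → v ∉ xs
Unique-head (v∉ ∷ _) v∈ = All.lookup v∉ v∈ refl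

same-swap : ∀ e u v → same e (u , v) ≡ same e (v , u)
same-swap e u v = trans (same-does e (u , v))
  (trans (does-⇔ (mk⇔ Sum.swap Sum.swap) (same? e (u , v)) (same? e (v , u))) (sym (same-does e (v , u))))

-- All that the computation needs to know about adjacency. Both an arbitrary caterpillar and `𝒮 D`
-- satisfy it, so one calculation serves the two sides. A pendant edge is marked by its outer end
-- `u` having no edge that avoids `v`; `once` is stated as a sum because it is used under a
-- summation over `E`.
record Shape (E : List Edge) (p : List ℕ) : Set where
  field
    unique   : Unique p
    classify : ∀ {e} → e ∈ E →
      (∃[ u ] ∃[ v ] (Consec u v p × SameEdge e (u , v)))
      ⊎ (∃[ v ] ∃[ u ] (v ∈ p × u ∉ p × SameEdge e (v , u) × (∀ {f} → f ∈ E → Inc u f → Inc v f)))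
    once     : ∀ u v → Consec u v p → Σℚ (λ e → ⟦ same e (u , v) ⟧) E ≡ 1ℚ

degree : List Edge → ℕ → ℕ
degree E v = length (filter (inc? v) E)

degree-Σ : ∀ E v → ℕ→ℚ (degree E v) ≡ Σℚ (λ e → ⟦ inc v e ⟧) E
degree-Σ []      v = refl
degree-Σ (e ∷ E) v with inc-cases v e
... | inj₁ (ve , eq) = trans (cong (ℕ→ℚ ∘ length) (filter-accept (inc? v) ve))
  (trans (ℕ→ℚ-suc (degree E v)) (cong₂ _+_ (cong ⟦_⟧ (sym eq)) (degree-Σ E v)))
... | inj₂ (¬ve , eq) = trans (cong (ℕ→ℚ ∘ length) (filter-reject (inc? v) ¬ve))
  (trans (degree-Σ E v) (trans (sym (+-identityˡ _)) (cong (_+ Σℚ (λ e → ⟦ inc v e ⟧) E) (cong ⟦_⟧ (sym eq)))))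

avoiding : List ℕ → EdgeSet
avoiding []      = const true
avoiding (v ∷ Δ) = avoiding Δ ∖ v

avoiding-true : ∀ Δ {e} → (∀ {w} → w ∈ Δ → ¬ Inc w e) → avoiding Δ e ≡ true
avoiding-true []      _ = refl
avoiding-true (v ∷ Δ) h = cong₂ (λ p q → p ∧ not q) (avoiding-true Δ (h ∘ there)) (inc-false (h (here refl)))

avoiding-false : ∀ Δ {e w} → w ∈ Δ → Inc w e → avoiding Δ e ≡ false
avoiding-false (v ∷ Δ) {e} (here refl) we = trans (cong (λ q → avoiding Δ e ∧ not q) (inc-true we)) (∧-zeroʳ (avoiding Δ e))
avoiding-false (v ∷ Δ) {e} (there w∈) we = cong (_∧ not (inc v e)) (avoiding-false Δ w∈ we)

link : List ℕ → ℕ → Edge → Bool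
link []      v e = false
link (u ∷ _) v e = same e (u , v)

module Spine (x : ℚ) (E : List Edge) (p : List ℕ) (shape : Shape E p) where
  open Matching x
  open Shape shape

  nextW : List ℕ → List ℕ → ℚ
  nextW Δ []      = 0ℚ
  nextW Δ (u ∷ _) = W (avoiding (u ∷ Δ)) E

  -- The roles of an edge once the spine vertices `pre` are deleted and `v` comes next. As `pre` is
  -- kept in reverse, its head is the predecessor of `v`. An edge to the predecessor is already
  -- gone, one to the successor deletes it as well, and choosing a pendant edge amounts to deleting
  -- `v` alone.
  data Kind (pre : List ℕ) (v : ℕ) (rest : List ℕ) (e : Edge) : Set where
    far  : inc v e ≡ false → link pre v e ≡ false → link rest v e ≡ false → Kind pre v rest e
    prev : inc v e ≡ true → link pre v e ≡ true → link rest v e ≡ false → avoiding pre e ≡ false → Kind pre v rest e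
    next : ∀ {u rest'} → rest ≡ u ∷ rest' → inc v e ≡ true → link pre v e ≡ false → link rest v e ≡ true →
           avoiding pre e ≡ true → (∀ f → disj e f ≡ not (inc v f) ∧ not (inc u f)) → Kind pre v rest e
    leaf : inc v e ≡ true → link pre v e ≡ false → link rest v e ≡ false →
           avoiding pre e ≡ true → (∀ {f} → f ∈ E → disj e f ≡ not (inc v f)) → Kind pre v rest e

  link-false : ∀ L {v e} → (∀ {u} → u ∈ L → ¬ SameEdge e (u , v)) → link L v e ≡ false
  link-false []      h = refl
  link-false (u ∷ _) h = same-false (h (here refl))

  kind : ∀ pre v rest → p ≡ pre ʳ++ (v ∷ rest) → ∀ {e} → e ∈ E → Kind pre v rest e
  kind pre v rest p≡ {e} e∈E with inc-cases v e
  ... | inj₂ (¬ve , eq) = far eq (link-false pre λ _ → ¬ve ∘ SameEdge⇒Incʳ) (link-false rest λ _ → ¬ve ∘ SameEdge⇒Incʳ)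
  ... | inj₁ (ve , eq) = by-class (classify e∈E)
    where
    u-all : Unique (v ∷ pre ++ rest)
    u-all = Unique-resp-↭ (ʳ++-↭ pre v rest) (subst Unique p≡ unique)
    v∉pre : v ∉ pre
    v∉pre = Unique-head u-all ∘ ∈-++⁺ˡ
    v∉rest : v ∉ rest
    v∉rest = Unique-head u-all ∘ ∈-++⁺ʳ pre
    pre#rest : ∀ {w} → w ∈ pre → w ∉ rest
    pre#rest = Unique-++-disjoint pre (AllPairs.tail u-all)
    ∈p : ∀ {w} → w ∈ v ∷ pre ++ rest → w ∈ p
    ∈p w∈ = subst (_ ∈_) (sym p≡) (∈-resp-↭ (↭-sym (ʳ++-↭ pre v rest)) w∈)
    v∉reverse : v ∉ reverse pre
    v∉reverse = v∉pre ∘ ∈-resp-↭ (↭-reverse pre)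
    p≡' : p ≡ reverse pre ++ v ∷ rest
    p≡' = trans p≡ (ʳ++-defn pre)

    other : ∀ {a w} → SameEdge e (v , a) → w ≢ v → Inc w e → w ≡ a
    other s w≢v we with SameEdge-Inc s we
    ... | inj₁ w≡v = contradiction w≡v w≢v
    ... | inj₂ w≡a = w≡a

    swap-edge : ∀ {e a c} → SameEdge e (a , c) → SameEdge e (c , a)
    swap-edge (inj₁ s) = inj₂ s
    swap-edge (inj₂ s) = inj₁ s

    -- `v` occurs only once in `p`, so the two splittings of `p` at `v` agree and the neighbour `a`
    -- is the head of `rest`.
    next-case : ∀ {a xs ys} → p ≡ xs ++ v ∷ a ∷ ys → SameEdge e (v , a) → Kind pre v rest e
    next-case {a} {xs} {ys} p≡xs s with split-at-unique (reverse pre) xs (trans (sym p≡') p≡xs) v∉reverse v∉xs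
      where
      v∉xs : v ∉ xs
      v∉xs v∈ = Unique-++-disjoint xs (subst Unique p≡xs unique) v∈ (here refl)
    ... | _ , refl = next refl eq
      (link-false pre λ {u} u∈ s' → pre#rest (subst (_∈ pre) (other s (λ u≡v → v∉pre (subst (_∈ pre) u≡v u∈)) (SameEdge⇒Incˡ s')) u∈) (here refl))
      (same-true (swap-edge s))
      (avoiding-true pre λ {w} w∈ we → pre#rest w∈ (here (other s (λ w≡v → v∉pre (subst (_∈ pre) w≡v w∈)) we)))
      (SameEdge-disj s)

    prev-case : ∀ {a xs ys} → p ≡ xs ++ a ∷ v ∷ ys → SameEdge e (v , a) → Kind pre v rest e
    prev-case {a} {xs} {ys} p≡xs s with split-at-unique (reverse pre) (xs ++ [ a ])
        (trans (sym p≡') (trans p≡xs (sym (++-assoc xs [ a ] (v ∷ ys))))) v∉reverse v∉xs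
      where
      v∉xs : v ∉ xs ++ [ a ]
      v∉xs v∈ = Unique-++-disjoint (xs ++ [ a ]) (subst Unique (trans p≡xs (sym (++-assoc xs [ a ] (v ∷ ys)))) unique) v∈ (here refl)
    ... | rev≡ , refl = with-pre (trans (sym (reverse-involutive pre)) (trans (cong reverse rev≡) (reverse-++ xs [ a ])))
      where
      with-pre : pre ≡ a ∷ reverse xs → Kind pre v rest e
      with-pre refl = prev eq (same-true (swap-edge s))
        (link-false rest λ {u} u∈ s' → pre#rest (here refl)
           (subst (_∈ rest) (other s (λ u≡v → v∉rest (subst (_∈ rest) u≡v u∈)) (SameEdge⇒Incˡ s')) u∈))
        (avoiding-false pre (here refl) (SameEdge⇒Incʳ s))

    leaf-case : ∀ {u} → u ∉ p → SameEdge e (v , u) → (∀ {f} → f ∈ E → Inc u f → Inc v f) → Kind pre v rest e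
    leaf-case {u} u∉p s only = leaf eq
      (link-false pre λ u'∈ s' → not-linked (there (∈-++⁺ˡ u'∈)) (λ { refl → v∉pre u'∈ }) s')
      (link-false rest λ u'∈ s' → not-linked (there (∈-++⁺ʳ pre u'∈)) (λ { refl → v∉rest u'∈ }) s')
      (avoiding-true pre λ {w} w∈ we → u∉p (subst (_∈ p) (other s (λ { refl → v∉pre w∈ }) we) (∈p (there (∈-++⁺ˡ w∈)))))
      (λ {f} f∈ → trans (SameEdge-disj s f) (drop-u f∈))
      where
      not-linked : ∀ {u'} → u' ∈ v ∷ pre ++ rest → u' ≢ v → ¬ SameEdge e (u' , v)
      not-linked u'∈ u'≢v s' = u∉p (subst (_∈ p) (other s u'≢v (SameEdge⇒Incˡ s')) (∈p u'∈))
      drop-u : ∀ {f} → f ∈ E → not (inc v f) ∧ not (inc u f) ≡ not (inc v f)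
      drop-u {f} f∈ with inc-cases u f
      ... | inj₁ (uf , equ) rewrite inc-true (only f∈ uf) = refl
      ... | inj₂ (_ , equ) rewrite equ = ∧-identityʳ _

    by-class : _ → Kind pre v rest e
    by-class (inj₁ (a , c , (xs , ys , p≡xs) , s)) with SameEdge-Inc s ve
    ... | inj₁ refl = next-case p≡xs s
    ... | inj₂ refl = prev-case p≡xs (swap-edge s)
    by-class (inj₂ (a , u , a∈p , u∉p , s , only)) with SameEdge-Inc s ve
    ... | inj₁ refl = leaf-case u∉p s only
    ... | inj₂ refl = contradiction (∈p (here refl)) u∉p

  -- One formula, linear in indicators, covers all kinds: each edge at `v` is first charged like a
  -- pendant one, then the two spine edges are corrected. Summed over `E`, the indicators become the
  -- degree and the numbers of spine neighbours.
  at-value : ∀ pre v rest → p ≡ pre ʳ++ (v ∷ rest) → ∀ {e} → e ∈ E →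
    at (avoiding pre) v E e ≡
      ⟦ inc v e ⟧ * W (avoiding (v ∷ pre)) E + (⟦ link pre v e ⟧ * (- W (avoiding (v ∷ pre)) E)
      + ⟦ link rest v e ⟧ * (nextW (v ∷ pre) rest - W (avoiding (v ∷ pre)) E))
  at-value pre v rest p≡ {e} e∈ with kind pre v rest p≡ e∈
  ... | far i l l' rewrite i | l | l' =
    solve 2 (λ w n → con 0ℚ := con 0ℚ :* w :+ (con 0ℚ :* (:- w) :+ con 0ℚ :* (n :- w)))
      refl (W (avoiding (v ∷ pre)) E) (nextW (v ∷ pre) rest)
  ... | prev i l l' a rewrite i | l | l' | a =
    solve 2 (λ w n → con 0ℚ := con 1ℚ :* w :+ (con 1ℚ :* (:- w) :+ con 0ℚ :* (n :- w)))
      refl (W (avoiding (v ∷ pre)) E) (nextW (v ∷ pre) rest)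
  ... | next {u} {rest'} refl i l l' a d rewrite i | l | l' | a = trans
    (W-cong E λ {f} _ → trans (cong (avoiding pre f ∧_) (d f)) (sym (∧-assoc (avoiding pre f) (not (inc v f)) (not (inc u f)))))
    (solve 2 (λ w n → n := con 1ℚ :* w :+ (con 0ℚ :* (:- w) :+ con 1ℚ :* (n :- w)))
      refl (W (avoiding (v ∷ pre)) E) (W (avoiding (u ∷ v ∷ pre)) E))
  ... | leaf i l l' a d rewrite i | l | l' | a = trans
    (W-cong E λ {f} f∈ → cong (avoiding pre f ∧_) (d f∈))
    (solve 2 (λ w n → w := con 1ℚ :* w :+ (con 0ℚ :* (:- w) :+ con 0ℚ :* (n :- w)))
      refl (W (avoiding (v ∷ pre)) E) (nextW (v ∷ pre) rest))

  links : List ℕ → ℚ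
  links []      = 0ℚ
  links (_ ∷ _) = 1ℚ

  Σ-link-next : ∀ pre v rest → p ≡ pre ʳ++ (v ∷ rest) → Σℚ (λ e → ⟦ link rest v e ⟧) E ≡ links rest
  Σ-link-next pre v []         p≡ = Σℚ-0 E (λ _ → refl)
  Σ-link-next pre v (u ∷ rest) p≡ = trans
    (Σℚ-cong E λ {e} _ → cong ⟦_⟧ (same-swap e u v))
    (once v u (reverse pre , rest , trans p≡ (ʳ++-defn pre)))

  Σ-link-prev : ∀ pre v rest → p ≡ pre ʳ++ (v ∷ rest) → Σℚ (λ e → ⟦ link pre v e ⟧) E ≡ links pre
  Σ-link-prev []        v rest p≡ = Σℚ-0 E (λ _ → refl)
  Σ-link-prev (u ∷ pre) v rest p≡ = once u v (reverse pre , rest , trans p≡ (ʳ++-defn pre))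

  W-step : ∀ pre v rest → p ≡ pre ʳ++ (v ∷ rest) → ∀ {w n} →
    W (avoiding (v ∷ pre)) E ≡ w → nextW (v ∷ pre) rest ≡ n →
    W (avoiding pre) E ≡ w + x * (ℕ→ℚ (degree E v) * w + (links pre * (- w) + links rest * (n - w)))
  W-step pre v rest p≡ {w} {n} refl refl = begin
    W (avoiding pre) E                          ≡⟨ W-vertex (avoiding pre) v E ⟩
    w + x * Σℚ (at (avoiding pre) v E) E        ≡⟨ cong (λ s → w + x * s) (begin
      Σℚ (at (avoiding pre) v E) E              ≡⟨ Σℚ-cong E (at-value pre v rest p≡) ⟩
      Σℚ (λ e → ⟦ inc v e ⟧ * w + (⟦ link pre v e ⟧ * (- w) + ⟦ link rest v e ⟧ * (n - w))) E
        ≡⟨ Σℚ-+ (λ e → ⟦ inc v e ⟧ * w) (λ e → ⟦ link pre v e ⟧ * (- w) + ⟦ link rest v e ⟧ * (n - w)) E ⟩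
      Σℚ (λ e → ⟦ inc v e ⟧ * w) E + Σℚ (λ e → ⟦ link pre v e ⟧ * (- w) + ⟦ link rest v e ⟧ * (n - w)) E
        ≡⟨ cong₂ _+_ (trans (Σℚ-*ʳ w (λ e → ⟦ inc v e ⟧) E) (cong (_* w) (sym (degree-Σ E v))))
             (trans (Σℚ-+ (λ e → ⟦ link pre v e ⟧ * (- w)) (λ e → ⟦ link rest v e ⟧ * (n - w)) E)
               (cong₂ _+_
                 (trans (Σℚ-*ʳ (- w) (λ e → ⟦ link pre v e ⟧) E) (cong (_* (- w)) (Σ-link-prev pre v rest p≡)))
                 (trans (Σℚ-*ʳ (n - w) (λ e → ⟦ link rest v e ⟧) E) (cong (_* (n - w)) (Σ-link-next pre v rest p≡))))) ⟩
      ℕ→ℚ (degree E v) * w + (links pre * (- w) + links rest * (n - w)) ∎) ⟩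
    w + x * (ℕ→ℚ (degree E v) * w + (links pre * (- w) + links rest * (n - w))) ∎
    where open ≡-Reasoning

  W-exhausted : ∀ pre → p ≡ pre ʳ++ [] → W (avoiding pre) E ≡ 1ℚ
  W-exhausted pre p≡ = W-none E λ e∈ → dead (classify e∈)
    where
    ∈pre : ∀ {v} → v ∈ p → v ∈ pre
    ∈pre v∈ = ∈-resp-↭ (↭-reverse pre) (subst (_ ∈_) (trans p≡ (trans (ʳ++-defn pre) (++-identityʳ (reverse pre)))) v∈)
    dead : ∀ {e} → _ → avoiding pre e ≡ false
    dead {e} (inj₁ (u , v , (xs , ys , eq) , s)) =
      avoiding-false pre (∈pre (subst (u ∈_) (sym eq) (∈-++⁺ʳ xs (here refl)))) (SameEdge⇒Incˡ {e} s)
    dead {e} (inj₂ (v , u , v∈p , _ , s , _)) = avoiding-false pre (∈pre v∈p) (SameEdge⇒Incˡ {e} s)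

  W-single : ∀ v → p ≡ [ v ] → W (const true) E ≡ 1ℚ + x * ℕ→ℚ (degree E v)
  W-single v p≡ = trans (W-step [] v [] p≡ (W-exhausted [ v ] p≡) refl)
    (solve 2 (λ x d → con 1ℚ :+ x :* (d :* con 1ℚ :+ (con 0ℚ :* (:- con 1ℚ) :+ con 0ℚ :* (con 0ℚ :- con 1ℚ)))
                   := con 1ℚ :+ x :* d) refl x (ℕ→ℚ (degree E v)))

  open Continuant x

  module _ (c : ℕ → ℕ) (deg≡ : ∀ {v} → v ∈ p → degree E v ≡ 2 ℕ.+ c v) where

    private
      deg-ℚ : ∀ pre v rest → p ≡ pre ʳ++ (v ∷ rest) → ℕ→ℚ (degree E v) ≡ 1ℚ + (1ℚ + ℕ→ℚ (c v))
      deg-ℚ pre v rest p≡ = trans (cong ℕ→ℚ (deg≡ v∈p)) (trans (ℕ→ℚ-suc (suc (c v))) (cong (1ℚ +_) (ℕ→ℚ-suc (c v))))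
        where
        v∈p : v ∈ p
        v∈p = subst (v ∈_) (sym p≡) (∈-resp-↭ (↭-sym (ʳ++-↭ pre v rest)) (here refl))

      K-[0] : K [ 0 ] ≡ 1ℚ
      K-[0] = solve 1 (λ x → (con 1ℚ :+ con 0ℚ :* x) :* con 1ℚ :+ x :* con 0ℚ := con 1ℚ) refl x

    -- A deleted vertex `u` ensures that `v` has a predecessor. With degree 2 + c the corrections
    -- leave `(1 + c x) w + x n` at an inner vertex; at the last one, with no successor, the surplus
    -- `x` is supplied by the final letter 0.
    W-suffix : ∀ u pre s → p ≡ (u ∷ pre) ʳ++ s → W (avoiding (u ∷ pre)) E ≡ K (map c s ++ [ 0 ])
    W-suffix u pre [] p≡ = trans (W-exhausted (u ∷ pre) p≡) (sym K-[0])
    W-suffix u pre (v ∷ []) p≡ = trans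
      (W-step (u ∷ pre) v [] p≡ (trans (W-suffix v (u ∷ pre) [] p≡) K-[0]) refl)
      (trans (cong (λ d → 1ℚ + x * (d * 1ℚ + (1ℚ * (- 1ℚ) + 0ℚ * (0ℚ - 1ℚ)))) (deg-ℚ (u ∷ pre) v [] p≡))
        (trans
          (solve 2 (λ x c → con 1ℚ :+ x :* ((con 1ℚ :+ (con 1ℚ :+ c)) :* con 1ℚ :+ (con 1ℚ :* (:- con 1ℚ) :+ con 0ℚ :* (con 0ℚ :- con 1ℚ)))
                         := (con 1ℚ :+ c :* x) :* con 1ℚ :+ x :* con 1ℚ) refl x (ℕ→ℚ (c v)))
          (cong (λ k → b (c v) * k + x * 1ℚ) (sym K-[0]))))
    W-suffix u pre (v ∷ v' ∷ s) p≡ = trans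
      (W-step (u ∷ pre) v (v' ∷ s) p≡ (W-suffix v (u ∷ pre) (v' ∷ s) p≡) (W-suffix v' (v ∷ u ∷ pre) s p≡))
      (trans (cong (λ d → w + x * (d * w + (1ℚ * (- w) + 1ℚ * (n - w)))) (deg-ℚ (u ∷ pre) v (v' ∷ s) p≡))
        (solve 4 (λ x c w n → w :+ x :* ((con 1ℚ :+ (con 1ℚ :+ c)) :* w :+ (con 1ℚ :* (:- w) :+ con 1ℚ :* (n :- w)))
                           := (con 1ℚ :+ c :* x) :* w :+ x :* n) refl x (ℕ→ℚ (c v)) w n))
      where
      w = K (map c (v' ∷ s) ++ [ 0 ])
      n = K (map c s ++ [ 0 ])

    -- The first vertex has no predecessor, so a summand `x * w` remains; it is the edge from the
    -- initial letter 0 to this vertex.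
    W-path : ∀ v v' s → p ≡ v ∷ v' ∷ s → W (const true) E ≡ K (0 ∷ map c p ++ [ 0 ])
    W-path v v' s p≡ = trans
      (W-step [] v (v' ∷ s) p≡ (W-suffix v [] (v' ∷ s) p≡) (W-suffix v' (v ∷ []) s p≡))
      (trans (cong (λ d → w + x * (d * w + (0ℚ * (- w) + 1ℚ * (n - w)))) (deg-ℚ [] v (v' ∷ s) p≡))
        (trans
          (solve 4 (λ x c w n → w :+ x :* ((con 1ℚ :+ (con 1ℚ :+ c)) :* w :+ (con 0ℚ :* (:- w) :+ con 1ℚ :* (n :- w)))
                             := (con 1ℚ :+ con 0ℚ :* x) :* ((con 1ℚ :+ c :* x) :* w :+ x :* n) :+ x :* w)
            refl x (ℕ→ℚ (c v)) w n)
          (cong (λ q → K (0 ∷ map c q ++ [ 0 ])) (sym p≡))))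
      where
      w = K (map c (v' ∷ s) ++ [ 0 ])
      n = K (map c s ++ [ 0 ])

-- Arbitrary caterpillars

SameEdge-common : ∀ {e f g} → SameEdge e g → SameEdge f g → SameEdge e f
SameEdge-common (inj₁ (refl , refl)) (inj₁ (refl , refl)) = inj₁ (refl , refl)
SameEdge-common (inj₁ (refl , refl)) (inj₂ (refl , refl)) = inj₂ (refl , refl)
SameEdge-common (inj₂ (refl , refl)) (inj₁ (refl , refl)) = inj₂ (refl , refl)
SameEdge-common (inj₂ (refl , refl)) (inj₂ (refl , refl)) = inj₁ (refl , refl)

Σ-same : ∀ E g {e} → AllPairs (λ e f → ¬ SameEdge e f) E → e ∈ E → SameEdge e g →
         Σℚ (λ e → ⟦ same e g ⟧) E ≡ 1ℚ
Σ-same (e ∷ E) g (e≁ ∷ _) (here refl) s = trans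
  (cong₂ _+_ (cong ⟦_⟧ (same-true s))
    (Σℚ-0 E λ {f} f∈ → cong ⟦_⟧ (same-false λ s' → All.lookup e≁ f∈ (SameEdge-common {e} {f} s s'))))
  (+-identityʳ 1ℚ)
Σ-same (a ∷ E) g {e} (a≁ ∷ d) (there e∈) s = trans
  (cong₂ _+_ (cong ⟦_⟧ (same-false λ s' → All.lookup a≁ e∈ (SameEdge-common {a} {e} s' s))) (Σ-same E g d e∈ s))
  (+-identityˡ 1ℚ)

degree-1-unique : ∀ {E u e f} → degree E u ≡ 1 → e ∈ E → f ∈ E → Inc u e → Inc u f → e ≡ f
degree-1-unique {E} {u} deg≡1 e∈ f∈ ue uf =
  go (filter (inc? u) E) deg≡1 (∈-filter⁺ (inc? u) e∈ ue) (∈-filter⁺ (inc? u) f∈ uf)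
  where
  go : ∀ {e f : Edge} L → length L ≡ 1 → e ∈ L → f ∈ L → e ≡ f
  go (_ ∷ []) _ (here refl) (here refl) = refl

degree-≢0 : ∀ {E v e} → e ∈ E → Inc v e → degree E v ≢ 0
degree-≢0 {E} {v} e∈ ve with filter (inc? v) E | ∈-filter⁺ (inc? v) e∈ ve
... | _ ∷ _ | _ = λ ()

consecutive-neighbour : ∀ {v} a b s → v ∈ a ∷ b ∷ s → ∃[ u ] (Consec u v (a ∷ b ∷ s) ⊎ Consec v u (a ∷ b ∷ s))
consecutive-neighbour a b s       (here refl)         = b , inj₂ ([] , s , refl)
consecutive-neighbour a b s       (there (here refl)) = a , inj₁ ([] , s , refl)
consecutive-neighbour a b (c ∷ s) (there (there v∈)) with consecutive-neighbour b c s (there v∈)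
... | u , inj₁ (xs , ys , eq) = u , inj₁ (a ∷ xs , ys , cong (a ∷_) eq)
... | u , inj₂ (xs , ys , eq) = u , inj₂ (a ∷ xs , ys , cong (a ∷_) eq)

Consec-∈ : ∀ {u v p} → Consec u v p → u ∈ p × v ∈ p
Consec-∈ ([]     , ys , refl) = here refl , there (here refl)
Consec-∈ (x ∷ xs , ys , refl) with Consec-∈ (xs , ys , refl)
... | u∈ , v∈ = there u∈ , there v∈

module Caterpillar (G : Graph) (caterpillar : IsCaterpillar G) where

  p : List ℕ
  p = proj₁ (proj₂ caterpillar)

  private
    wellFormed : WellFormed G
    wellFormed = proj₁ (proj₁ caterpillar)
    distinct : AllPairs (λ e f → ¬ SameEdge e f) (E G)
    distinct = proj₂ (proj₁ (proj₂ (proj₁ caterpillar)))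
    connected : Connected G
    connected = proj₁ (proj₂ (proj₂ (proj₂ (proj₁ caterpillar))))
    unique-p : Unique p
    unique-p = proj₁ (proj₂ (proj₂ caterpillar))
    nonLeaf : ∀ v → (v ∈ p) ⇔ NonLeaf G v
    nonLeaf = proj₁ (proj₂ (proj₂ (proj₂ caterpillar)))
    path : ∀ u v → u ∈ p → v ∈ p → Adj G u v ⇔ (Consec u v p ⊎ Consec v u p)
    path = proj₂ (proj₂ (proj₂ (proj₂ caterpillar)))

    Adj⇒edge : ∀ {u v} → Adj G u v → ∃[ e ] (e ∈ E G × SameEdge e (u , v))
    Adj⇒edge (inj₁ e∈) = _ , e∈ , inj₁ (refl , refl)
    Adj⇒edge (inj₂ e∈) = _ , e∈ , inj₂ (refl , refl)

    ∉p⇒degree-1 : ∀ {v} → v ℕ.< V G → v ∉ p → deg G v ≡ 1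
    ∉p⇒degree-1 {v} v<V v∉p with deg G v ℕₚ.≟ 1
    ... | yes d≡1 = d≡1
    ... | no  d≢1 = contradiction (Equivalence.from (nonLeaf v) (v<V , d≢1)) v∉p

    degree-1⇒∉p : ∀ {v} → deg G v ≡ 1 → v ∉ p
    degree-1⇒∉p {v} d≡1 v∈p = proj₂ (Equivalence.to (nonLeaf v) v∈p) d≡1

    -- Two adjacent vertices of degree 1 have no edge other than the one joining them, so no walk
    -- leaves the pair.
    component-K₂ : ∀ {a b} → (a , b) ∈ E G → deg G a ≡ 1 → deg G b ≡ 1 →
                   ∀ {u r} → Star (Adj G) u r → u ≡ a ⊎ u ≡ b → r ≡ a ⊎ r ≡ b
    component-K₂ ab∈ da db ε        u∈ = u∈
    component-K₂ {a} {b} ab∈ da db (_◅_ {j = w} uw walk) u∈ = component-K₂ ab∈ da db walk (step (Adj⇒edge uw) u∈)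
      where
      step : ∀ {u} → ∃[ e ] (e ∈ E G × SameEdge e (u , w)) → u ≡ a ⊎ u ≡ b → w ≡ a ⊎ w ≡ b
      step (e , e∈ , s) (inj₁ refl) with refl ← degree-1-unique da e∈ ab∈ (SameEdge⇒Incˡ {e} s) (inj₁ refl) =
        Sum.map sym sym (SameEdge⇒Incʳ {e} s)
      step (e , e∈ , s) (inj₂ refl) with refl ← degree-1-unique db e∈ ab∈ (SameEdge⇒Incˡ {e} s) (inj₂ refl) =
        Sum.map sym sym (SameEdge⇒Incʳ {e} s)

  -- A spine vertex `r` rules out the graph K₂, whose only edge joins two leaves: by connectedness
  -- `r` would be one of them.
  shape : ∀ {r} → r ∈ p → Shape (E G) p
  shape {r} r∈p = record
    { unique   = unique-p
    ; classify = λ {e} e∈ → classify e∈ (proj₁ e ∈p?) (proj₂ e ∈p?)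
    ; once     = λ u v c → once u v c
    }
    where
    _∈p? : ∀ v → Dec (v ∈ p)
    v ∈p? = member? ℕₚ._≟_ v p

    leaf-only : ∀ {e v u} → e ∈ E G → deg G u ≡ 1 → SameEdge e (v , u) → ∀ {f} → f ∈ E G → Inc u f → Inc v f
    leaf-only {e} e∈ du s f∈ uf =
      subst (Inc _) (degree-1-unique du e∈ f∈ (SameEdge⇒Incʳ {e} s) uf) (SameEdge⇒Incˡ {e} s)

    classify : ∀ {e} → e ∈ E G → Dec (proj₁ e ∈ p) → Dec (proj₂ e ∈ p) →
      (∃[ u ] ∃[ v ] (Consec u v p × SameEdge e (u , v)))
      ⊎ (∃[ v ] ∃[ u ] (v ∈ p × u ∉ p × SameEdge e (v , u) × (∀ {f} → f ∈ E G → Inc u f → Inc v f)))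
    classify {a , b} e∈ (yes a∈p) (yes b∈p) with Equivalence.to (path a b a∈p b∈p) (inj₁ e∈)
    ... | inj₁ c = inj₁ (a , b , c , inj₁ (refl , refl))
    ... | inj₂ c = inj₁ (b , a , c , inj₂ (refl , refl))
    classify {a , b} e∈ (yes a∈p) (no b∉p) = inj₂ (a , b , a∈p , b∉p , inj₁ (refl , refl) ,
      leaf-only e∈ (∉p⇒degree-1 (proj₂ (All.lookup wellFormed e∈)) b∉p) (inj₁ (refl , refl)))
    classify {a , b} e∈ (no a∉p) (yes b∈p) = inj₂ (b , a , b∈p , a∉p , inj₂ (refl , refl) ,
      leaf-only e∈ (∉p⇒degree-1 (proj₁ (All.lookup wellFormed e∈)) a∉p) (inj₂ (refl , refl)))
    classify {a , b} e∈ (no a∉p) (no b∉p) = contradiction r∈p (degree-1⇒∉p dr)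
      where
      a<V = proj₁ (All.lookup wellFormed e∈)
      da = ∉p⇒degree-1 a<V a∉p
      db = ∉p⇒degree-1 (proj₂ (All.lookup wellFormed e∈)) b∉p
      dr : deg G r ≡ 1
      dr with component-K₂ e∈ da db (connected a r a<V (proj₁ (Equivalence.to (nonLeaf r) r∈p))) (inj₁ refl)
      ... | inj₁ r≡a = trans (cong (deg G) r≡a) da
      ... | inj₂ r≡b = trans (cong (deg G) r≡b) db

    once : ∀ u v → Consec u v p → Σℚ (λ e → ⟦ same e (u , v) ⟧) (E G) ≡ 1ℚ
    once u v c with Consec-∈ c
    ... | u∈p , v∈p with Adj⇒edge (Equivalence.from (path u v u∈p v∈p) (inj₁ c))
    ...   | e , e∈ , s = Σ-same (E G) (u , v) distinct e∈ s

  p↭nonLeaves : p ↭ filter (λ v → ¬? (deg G v ℕₚ.≟ 1)) (upTo (V G))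
  p↭nonLeaves = ∼bag⇒↭ (unique∧set⇒bag unique-p (Uniqueₚ.filter⁺ _ (Uniqueₚ.upTo⁺ (V G)))
    (λ {v} → mk⇔
      (λ v∈p → let v<V , d≢1 = Equivalence.to (nonLeaf v) v∈p in ∈-filter⁺ (λ v → ¬? (deg G v ℕₚ.≟ 1)) (∈-upTo⁺ v<V) d≢1)
      (λ v∈ → let v∈upTo , d≢1 = ∈-filter⁻ (λ v → ¬? (deg G v ℕₚ.≟ 1)) {xs = upTo (V G)} v∈ in
              Equivalence.from (nonLeaf v) (∈-upTo⁻ v∈upTo , d≢1))))

  degrees↭ : ∀ {D} → ReducedDegSeq G D → map (deg G) p ↭ D
  degrees↭ (_ , ↭D) = ↭-trans (Permₚ.map⁺ (deg G) p↭nonLeaves) ↭D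

  -- On a spine with at least two vertices each vertex has a spine neighbour, so its degree is not
  -- 0, and as a non-leaf it does not have degree 1.
  degree-≥2 : ∀ {v a b s} → p ≡ a ∷ b ∷ s → v ∈ p → 2 ℕ.≤ deg G v
  degree-≥2 {v} {a} {b} {s} p≡ v∈p with subst (λ q → ∃[ u ] (Consec u v q ⊎ Consec v u q)) (sym p≡)
                                            (consecutive-neighbour a b s (subst (v ∈_) p≡ v∈p))
  ... | u , c with Adj⇒edge (Equivalence.from (path u v (u∈p c) v∈p) c)
    where
    u∈p : Consec u v p ⊎ Consec v u p → u ∈ p
    u∈p = [ proj₁ ∘ Consec-∈ , proj₂ ∘ Consec-∈ ]′
  ...   | e , e∈ , s = ≥2 (degree-≢0 {E G} {v} e∈ (SameEdge⇒Incʳ {e} s)) (proj₂ (Equivalence.to (nonLeaf v) v∈p))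
    where
    ≥2 : ∀ {n} → n ≢ 0 → n ≢ 1 → 2 ℕ.≤ n
    ≥2 {zero} n≢0 n≢1 = contradiction refl n≢0
    ≥2 {suc zero} n≢0 n≢1 = contradiction refl n≢1
    ≥2 {suc (suc n)} n≢0 n≢1 = ℕ.s≤s (ℕ.s≤s ℕ.z≤n)

  module _ (x : ℚ) where
    open Continuant x
    open Matching x using (M≡W)

    -- A spine of one vertex may have degree 0, where `d ∸ 2` would truncate, so this case works
    -- with `d` itself.
    M-star : ∀ {d} → ReducedDegSeq G (d ∷ []) → M G x ≡ 1ℚ + x * ℕ→ℚ d
    M-star {d} rds = go p refl (degrees↭ rds)
      where
      go : ∀ q → p ≡ q → map (deg G) q ↭ d ∷ [] → M G x ≡ 1ℚ + x * ℕ→ℚ d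
      go []          p≡q ↭d = contradiction (↭-length ↭d) λ ()
      go (v ∷ [])    p≡q ↭d = trans (M≡W G) (trans
        (Spine.W-single x (E G) p (shape (subst (v ∈_) (sym p≡q) (here refl))) v p≡q)
        (cong (λ d → 1ℚ + x * ℕ→ℚ d) (proj₁ (∷-injective (↭-singleton-inv ↭d)))))
      go (_ ∷ _ ∷ _) p≡q ↭d = contradiction (↭-length ↭d) λ ()

    -- The bound 2 on the entries of `D` is read off from the caterpillar; the computation for `𝒮 D`
    -- relies on it.
    M-path : ∀ {d d' D} → ReducedDegSeq G (d ∷ d' ∷ D) →
      All (2 ℕ.≤_) (d ∷ d' ∷ D) × ∃[ w ] (w ↭ map (ℕ._∸ 2) (d ∷ d' ∷ D) × M G x ≡ K (0 ∷ w ++ [ 0 ]))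
    M-path {d} {d'} {D} rds = go p refl (degrees↭ rds)
      where
      go : ∀ q → p ≡ q → map (deg G) q ↭ d ∷ d' ∷ D → All (2 ℕ.≤_) (d ∷ d' ∷ D) × ∃[ w ] (w ↭ map (ℕ._∸ 2) (d ∷ d' ∷ D) × M G x ≡ K (0 ∷ w ++ [ 0 ]))
      go []           p≡q ↭D = contradiction (↭-length ↭D) λ ()
      go (_ ∷ [])     p≡q ↭D = contradiction (↭-length ↭D) λ ()
      go (v ∷ v' ∷ s) p≡q _ =
        All-resp-↭ (degrees↭ rds) (Allₚ.map⁺ (All.tabulate (degree-≥2 p≡q))) ,
        map c p ,
        ↭-trans (↭-reflexive (map-∘ p)) (Permₚ.map⁺ (ℕ._∸ 2) (degrees↭ rds)) ,
        trans (M≡W G) (Spine.W-path x (E G) p (shape (subst (v ∈_) (sym p≡q) (here refl))) c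
          (λ v∈p → sym (ℕₚ.m+[n∸m]≡n (degree-≥2 p≡q v∈p))) v v' s p≡q)
        where
        c : ℕ → ℕ
        c v = deg G v ℕ.∸ 2

-- The arrangement eSeq

Zigzag-↭ : ∀ {D e} → Zigzag D e → e ↭ D
Zigzag-↭ empty      = ↭-refl
Zigzag-↭ (single d) = ↭-refl
Zigzag-↭ (outer {c} {d} {D} {e} z) =
  ↭-prep c (↭-trans (↭-sym (∷↭∷ʳ d e)) (↭-prep d (↭-trans (Zigzag-↭ z) (↭-reverse D))))

-- `Zigzag` rearranges by position only, so it passes from degrees d to letters d - 2.
Zigzag-map : ∀ (f : ℕ → ℕ) {D e} → Zigzag D e → Zigzag (map f D) (map f e)
Zigzag-map f empty      = empty
Zigzag-map f (single d) = single (f d)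
Zigzag-map f (outer {c} {d} {D} {e} z) = subst (λ u → Zigzag (f c ∷ f d ∷ map f D) (f c ∷ u))
  (sym (map-++ f e [ d ])) (outer (subst (λ u → Zigzag u (map f e)) (reverse-map f D) (Zigzag-map f z)))

nth-∷ʳ-last : ∀ xs d → nth (xs ++ [ d ]) (suc (length xs)) ≡ d
nth-∷ʳ-last []       d = refl
nth-∷ʳ-last (x ∷ xs) d = nth-∷ʳ-last xs d

nth-∷ʳ : ∀ xs d {i} → i ℕ.< length xs → nth (xs ++ [ d ]) (suc i) ≡ nth xs (suc i)
nth-∷ʳ (x ∷ xs) d {zero}  _          = refl
nth-∷ʳ (x ∷ xs) d {suc i} (ℕ.s≤s i<) = nth-∷ʳ xs d i<

nth-suc : ∀ d ds {j} → 0 ℕ.< j → nth (d ∷ ds) (suc j) ≡ nth ds j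
nth-suc d ds {suc j} _ = refl

nth-reverse : ∀ ds {i} → i ℕ.< length ds → nth (reverse ds) (suc i) ≡ nth ds (length ds ∸ i)
nth-reverse (d ∷ ds) {i} (ℕ.s≤s i≤) rewrite unfold-reverse d ds with ℕₚ.m≤n⇒m<n∨m≡n i≤
... | inj₂ refl = begin
  nth (reverse ds ++ [ d ]) (suc (length ds))           ≡⟨ cong (λ n → nth (reverse ds ++ [ d ]) (suc n)) (sym (length-reverse ds)) ⟩
  nth (reverse ds ++ [ d ]) (suc (length (reverse ds))) ≡⟨ nth-∷ʳ-last (reverse ds) d ⟩
  d                                                     ≡⟨ cong (nth (d ∷ ds)) (sym (ℕₚ.m+n∸n≡m 1 (length ds))) ⟩
  nth (d ∷ ds) (suc (length ds) ∸ length ds)            ∎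
  where open ≡-Reasoning
... | inj₁ i< = begin
  nth (reverse ds ++ [ d ]) (suc i)    ≡⟨ nth-∷ʳ (reverse ds) d (subst (i ℕ.<_) (sym (length-reverse ds)) i<) ⟩
  nth (reverse ds) (suc i)             ≡⟨ nth-reverse ds i< ⟩
  nth ds (length ds ∸ i)               ≡⟨ sym (nth-suc d ds (ℕₚ.m<n⇒0<n∸m i<)) ⟩
  nth (d ∷ ds) (suc (length ds ∸ i))   ≡⟨ cong (nth (d ∷ ds)) (sym (ℕₚ.+-∸-assoc 1 i≤)) ⟩
  nth (d ∷ ds) (suc (length ds) ∸ i)   ∎
  where open ≡-Reasoning

isOdd-suc : ∀ n → isOdd (suc n) ≡ not (isOdd n)
isOdd-suc zero          = refl
isOdd-suc (suc zero)    = refl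
isOdd-suc (suc (suc n)) = isOdd-suc n

isOdd⇒0< : ∀ {n} → isOdd n ≡ true → 0 ℕ.< n
isOdd⇒0< {suc n} _ = ℕ.s≤s ℕ.z≤n

-- eSeq with the length as a separate argument, so that it can be rewritten
eSeqₙ : ℕ → List ℕ → ℕ → ℕ
eSeqₙ n D j =
  if j ≤ᵇ ⌈ n /2⌉
    then (if isOdd j then nth D j else nth D ((2 ℕ.+ n) ∸ j))
    else (if isOdd ((1 ℕ.+ n) ∸ j) then nth D ((2 ℕ.+ n) ∸ j) else nth D j)

module _ (c d : ℕ) (D : List ℕ) where

  private
    n = length D

  -- Dropping both ends moves each position by one and so flips the parity tests in both halves;
  -- reversing `D` exchanges the indices of the two branches, which compensates for the flip.
  eSeq-inner : ∀ {i} → i ℕ.< n → eSeq (c ∷ d ∷ D) (suc (suc i)) ≡ eSeq (reverse D) (suc i)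
  eSeq-inner {i} i<n = trans inner (cong (λ n → eSeqₙ n (reverse D) (suc i)) (sym (length-reverse D)))
    where
    i≤n = ℕₚ.<⇒≤ i<n
    right : nth (c ∷ d ∷ D) (suc (suc n) ∸ i) ≡ nth (reverse D) (suc i)
    right = begin
      nth (c ∷ d ∷ D) (suc (suc n) ∸ i)     ≡⟨ cong (nth (c ∷ d ∷ D)) (ℕₚ.+-∸-assoc 2 i≤n) ⟩
      nth (c ∷ d ∷ D) (suc (suc (n ∸ i)))   ≡⟨ nth-suc d D (ℕₚ.m<n⇒0<n∸m i<n) ⟩
      nth D (n ∸ i)                         ≡⟨ sym (nth-reverse D i<n) ⟩
      nth (reverse D) (suc i)               ∎
      where open ≡-Reasoning
    left : 0 ℕ.< i → nth (c ∷ d ∷ D) (suc (suc i)) ≡ nth (reverse D) (suc n ∸ i)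
    left 0<i = begin
      nth (c ∷ d ∷ D) (suc (suc i))  ≡⟨ nth-suc d D 0<i ⟩
      nth D i                        ≡⟨ cong (nth D) (sym (ℕₚ.m∸[m∸n]≡n i≤n)) ⟩
      nth D (n ∸ (n ∸ i))            ≡⟨ sym (nth-reverse D (ℕₚ.∸-monoʳ-< {n} 0<i i≤n)) ⟩
      nth (reverse D) (suc (n ∸ i))  ≡⟨ cong (nth (reverse D)) (sym (ℕₚ.+-∸-assoc 1 i≤n)) ⟩
      nth (reverse D) (suc n ∸ i)    ∎
      where open ≡-Reasoning
    -- The first inner position always lies in the left half, so the right half never reaches index
    -- 0, where `nth` falls back on its default.
    0<i : (suc i ≤ᵇ ⌈ n /2⌉) ≡ false → 0 ℕ.< i
    0<i = go i n i<n
      where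
      go : ∀ i n → i ℕ.< n → (suc i ≤ᵇ ⌈ n /2⌉) ≡ false → 0 ℕ.< i
      go (suc i) n             _ _  = ℕ.s≤s ℕ.z≤n
      go zero    (suc zero)    _ ()
      go zero    (suc (suc n)) _ ()
    inner : eSeq (c ∷ d ∷ D) (suc (suc i)) ≡ eSeqₙ n (reverse D) (suc i)
    inner with suc i ≤ᵇ ⌈ n /2⌉ in early
    ... | true rewrite isOdd-suc i with isOdd i in odd
    ...   | true  = left (isOdd⇒0< odd)
    ...   | false = right
    inner | false rewrite ℕₚ.+-∸-assoc 1 i≤n | isOdd-suc (n ∸ i) with isOdd (n ∸ i)
    ...   | true  = trans (left (0<i early)) (cong (nth (reverse D)) (ℕₚ.+-∸-assoc 1 i≤n))
    ...   | false = right

  eSeq-last : eSeq (c ∷ d ∷ D) (suc (suc n)) ≡ d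
  eSeq-last = trans (if-false′ late)
    (cong₂ (λ j k → if isOdd j then nth (c ∷ d ∷ D) k else nth (c ∷ d ∷ D) (suc (suc n)))
       (ℕₚ.m+n∸n≡m 1 n) (ℕₚ.m+n∸n≡m 2 n))
    where
    if-false′ : ∀ {t} {k l : ℕ} → t ≡ false → (if t then k else l) ≡ l
    if-false′ refl = refl
    late : (suc n ≤ᵇ ⌈ n /2⌉) ≡ false
    late with suc n ≤ᵇ ⌈ n /2⌉ in eq
    ... | false = refl
    ... | true  = contradiction (ℕₚ.≤-trans (ℕₚ.≤ᵇ⇒≤ (suc n) ⌈ n /2⌉ (subst T (sym eq) _)) (ℕₚ.⌈n/2⌉≤n n)) (ℕₚ.n≮n n)

spineDegrees : List ℕ → List ℕ
spineDegrees D = map (λ i → eSeq D (suc i)) (upTo (length D))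

applyUpTo-cong : ∀ {f g : ℕ → ℕ} n → (∀ {i} → i ℕ.< n → f i ≡ g i) → applyUpTo f n ≡ applyUpTo g n
applyUpTo-cong zero    f≡g = refl
applyUpTo-cong (suc n) f≡g = cong₂ _∷_ (f≡g (ℕ.s≤s ℕ.z≤n)) (applyUpTo-cong n (λ i<n → f≡g (ℕ.s≤s i<n)))

spineDegrees-outer : ∀ c d D → spineDegrees (c ∷ d ∷ D) ≡ c ∷ spineDegrees (reverse D) ++ [ d ]
spineDegrees-outer c d D = begin
  spineDegrees (c ∷ d ∷ D)                       ≡⟨ map-upTo e (suc (suc n)) ⟩
  c ∷ applyUpTo (λ i → e (suc i)) (suc n)        ≡⟨ cong (c ∷_) (sym (applyUpTo-∷ʳ (λ i → e (suc i)) n)) ⟩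
  c ∷ applyUpTo (λ i → e (suc i)) n ++ [ e (suc n) ]
    ≡⟨ cong₂ (λ u l → c ∷ u ++ [ l ]) (applyUpTo-cong n (eSeq-inner c d D)) (eSeq-last c d D) ⟩
  c ∷ applyUpTo (λ i → eSeq (reverse D) (suc i)) n ++ [ d ]
    ≡⟨ cong (λ u → c ∷ u ++ [ d ]) (trans (sym (map-upTo (λ i → eSeq (reverse D) (suc i)) n))
         (cong (λ n → map (λ i → eSeq (reverse D) (suc i)) (upTo n)) (sym (length-reverse D)))) ⟩
  c ∷ spineDegrees (reverse D) ++ [ d ]          ∎
  where
  open ≡-Reasoning
  n = length D
  e = λ i → eSeq (c ∷ d ∷ D) (suc i)

spineDegrees-zigzag : ∀ D → Zigzag D (spineDegrees D)
spineDegrees-zigzag D = go (length D) D ℕₚ.≤-refl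
  where
  -- The recursive call is on `reverse D`, which is shorter but not a subterm; the bound on the
  -- length makes the recursion structural.
  go : ∀ fuel D → length D ℕ.≤ fuel → Zigzag D (spineDegrees D)
  go _          []          _ = empty
  go _          (d ∷ [])    _ = single d
  go (suc fuel) (c ∷ d ∷ D) (ℕ.s≤s n<fuel) = subst (Zigzag (c ∷ d ∷ D)) (sym (spineDegrees-outer c d D))
    (outer (go fuel (reverse D) (subst (ℕ._≤ fuel) (sym (length-reverse D)) (ℕₚ.<⇒≤ n<fuel))))

-- The caterpillar 𝒮 D

degree-++ : ∀ E F v → degree (E ++ F) v ≡ degree E v ℕ.+ degree F v
degree-++ E F v = trans (cong length (filter-++ (inc? v) E F)) (length-++ (filter (inc? v) E))

degree-none : ∀ E v → (∀ {e} → e ∈ E → ¬ Inc v e) → degree E v ≡ 0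
degree-none E v none = cong length (filter-none (inc? v) (All.tabulate none))

pathEdges : ℕ → List Edge
pathEdges m = map (λ i → (i , suc i)) (upTo m)

∈-pathEdges : ∀ {e} m → e ∈ pathEdges m → ∃[ i ] (i ℕ.< m × e ≡ (i , suc i))
∈-pathEdges m e∈ with ∈-map⁻ (λ i → (i , suc i)) e∈
... | i , i∈ , refl = i , ∈-upTo⁻ i∈ , refl

pathEdges-suc : ∀ m → pathEdges (suc m) ≡ pathEdges m ++ [ (m , suc m) ]
pathEdges-suc m = trans (cong (map (λ i → (i , suc i))) (sym (upTo-∷ʳ m))) (map-++ (λ i → (i , suc i)) (upTo m) [ m ])

pathEdges-≤ : ∀ m {e v} → e ∈ pathEdges m → Inc v e → v ℕ.≤ m
pathEdges-≤ m e∈ ve with ∈-pathEdges m e∈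
pathEdges-≤ m e∈ (inj₁ refl) | i , i<m , refl = ℕₚ.<⇒≤ i<m
pathEdges-≤ m e∈ (inj₂ refl) | i , i<m , refl = i<m

degree-single : ∀ {e v} → Inc v e → degree [ e ] v ≡ 1
degree-single {e} {v} ve = cong length (filter-accept (inc? v) {xs = []} ve)

degree-path-suc : ∀ m v → degree (pathEdges (suc m)) v ≡ degree (pathEdges m) v ℕ.+ degree [ (m , suc m) ] v
degree-path-suc m v = trans (cong (λ E → degree E v) (pathEdges-suc m)) (degree-++ (pathEdges m) [ (m , suc m) ] v)

degree-path-last : ∀ m → degree (pathEdges (suc m)) (suc m) ≡ 1
degree-path-last m = trans (degree-path-suc m (suc m)) (cong₂ ℕ._+_
  (degree-none (pathEdges m) (suc m) (λ e∈ ve → ℕₚ.n≮n m (pathEdges-≤ m e∈ ve)))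
  (degree-single {m , suc m} (inj₂ refl)))

degree-path-first : ∀ m → degree (pathEdges (suc m)) 0 ≡ 1
degree-path-first zero    = refl
degree-path-first (suc m) = trans (degree-path-suc (suc m) 0) (cong₂ ℕ._+_ (degree-path-first m)
  (degree-none [ (suc m , suc (suc m)) ] 0 λ { (here refl) (inj₁ ()) ; (here refl) (inj₂ ()) }))

degree-path-inner : ∀ m v → suc v ℕ.< m → degree (pathEdges m) (suc v) ≡ 2
degree-path-inner (suc m) v v<m with ℕₚ.m<1+n⇒m<n∨m≡n v<m
... | inj₂ refl = trans (degree-path-suc m (suc v)) (cong₂ ℕ._+_ (degree-path-last v) (degree-single {m , suc m} (inj₁ refl)))
... | inj₁ v<m' = trans (degree-path-suc m (suc v)) (cong₂ ℕ._+_ (degree-path-inner m v v<m')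
  (degree-none [ (m , suc m) ] (suc v) λ { (here refl) (inj₁ refl) → ℕₚ.n≮n m v<m'
                                         ; (here refl) (inj₂ refl) → ℕₚ.n≮n v (ℕₚ.<⇒≤ v<m') }))

∈-attach : ∀ v c s {e} → e ∈ attach v c s → ∃[ i ] (i ℕ.< c × e ≡ (v , s ℕ.+ i))
∈-attach v c s e∈ with ∈-map⁻ (λ i → (v , s ℕ.+ i)) e∈
... | i , i∈ , refl = i , ∈-upTo⁻ i∈ , refl

∈-leafEdges : ∀ spec {s e} → e ∈ leafEdges spec s → proj₁ e ∈ map proj₁ spec × s ℕ.≤ proj₂ e
∈-leafEdges ((v , c) ∷ r) {s} e∈ with ∈-++⁻ (attach v c s) e∈
... | inj₁ e∈a with ∈-attach v c s e∈a
...   | i , _ , refl = here refl , ℕₚ.m≤m+n s i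
∈-leafEdges ((v , c) ∷ r) {s} e∈ | inj₂ e∈r with ∈-leafEdges r e∈r
...   | v∈ , s≤ = there v∈ , ℕₚ.≤-trans (ℕₚ.m≤m+n s c) s≤

-- The spine vertices receive consecutive disjoint intervals of leaf numbers, so a leaf number
-- determines its spine vertex.
leafEdges-owner : ∀ spec {s v v' u} → (v , u) ∈ leafEdges spec s → (v' , u) ∈ leafEdges spec s → v ≡ v'
leafEdges-owner ((k , c) ∷ r) {s} e∈ f∈ with ∈-++⁻ (attach k c s) e∈ | ∈-++⁻ (attach k c s) f∈
... | inj₂ e∈r | inj₂ f∈r = leafEdges-owner r e∈r f∈r
... | inj₁ e∈a | inj₁ f∈a with ∈-attach k c s e∈a | ∈-attach k c s f∈a
...   | i , _ , refl | j , _ , eq = sym (cong proj₁ eq)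
leafEdges-owner ((k , c) ∷ r) {s} e∈ f∈ | inj₁ e∈a | inj₂ f∈r with ∈-attach k c s e∈a
...   | i , i<c , refl = contradiction (proj₂ (∈-leafEdges r f∈r)) (ℕₚ.<⇒≱ (ℕₚ.+-monoʳ-< s i<c))
leafEdges-owner ((k , c) ∷ r) {s} e∈ f∈ | inj₂ e∈r | inj₁ f∈a with ∈-attach k c s f∈a
...   | i , i<c , refl = contradiction (proj₂ (∈-leafEdges r e∈r)) (ℕₚ.<⇒≱ (ℕₚ.+-monoʳ-< s i<c))

Inc-leafEdges : ∀ spec {s e v} → e ∈ leafEdges spec s → v ℕ.< s → Inc v e → v ∈ map proj₁ spec
Inc-leafEdges spec e∈ v<s (inj₁ refl) = proj₁ (∈-leafEdges spec e∈)
Inc-leafEdges spec e∈ v<s (inj₂ refl) = contradiction (proj₂ (∈-leafEdges spec e∈)) (ℕₚ.<⇒≱ v<s)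

degree-attach : ∀ v c s → degree (attach v c s) v ≡ c
degree-attach v c s = trans
  (cong length (filter-all (inc? v) {attach v c s} (All.tabulate λ e∈ → inj₁ (owner e∈))))
  (trans (length-map (λ i → (v , s ℕ.+ i)) (upTo c)) (length-upTo c))
  where
  owner : ∀ {e} → e ∈ attach v c s → proj₁ e ≡ v
  owner e∈ with ∈-attach v c s e∈
  ... | _ , _ , refl = refl

degree-leafEdges : ∀ spec {s v c} → Unique (map proj₁ spec) → (v , c) ∈ spec → v ℕ.< s →
                   degree (leafEdges spec s) v ≡ c
degree-leafEdges ((v , c) ∷ r) {s} u (here refl) v<s = trans (degree-++ (attach v c s) (leafEdges r (s ℕ.+ c)) v)
  (trans (cong₂ ℕ._+_ (degree-attach v c s)
    (degree-none (leafEdges r (s ℕ.+ c)) v λ e∈ ve → Unique-head u (Inc-leafEdges r e∈ (ℕₚ.<-≤-trans v<s (ℕₚ.m≤m+n s c)) ve)))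
    (ℕₚ.+-identityʳ c))
degree-leafEdges ((k , d) ∷ r) {s} {v} u@(_ ∷ u') (there vc∈) v<s = trans (degree-++ (attach k d s) (leafEdges r (s ℕ.+ d)) v)
  (cong₂ ℕ._+_ (degree-none (attach k d s) v other) (degree-leafEdges r u' vc∈ (ℕₚ.<-≤-trans v<s (ℕₚ.m≤m+n s d))))
  where
  other : ∀ {e} → e ∈ attach k d s → ¬ Inc v e
  other e∈ ve with ∈-attach k d s e∈
  other e∈ (inj₁ refl) | i , _ , refl = Unique-head u (∈-map⁺ proj₁ vc∈)
  other e∈ (inj₂ refl) | i , _ , refl = ℕₚ.m+n≮m s i v<s

-- Stated for every `f`, because the tail of `applyUpTo f` is built from `f ∘ suc`; it is applied
-- with the identity.
Consec-applyUpTo⁺ : ∀ (f : ℕ → ℕ) n i → suc i ℕ.< n → Consec (f i) (f (suc i)) (applyUpTo f n)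
Consec-applyUpTo⁺ f (suc (suc n)) zero    _ = [] , applyUpTo (λ i → f (suc (suc i))) n , refl
Consec-applyUpTo⁺ f (suc n) (suc i) (ℕ.s≤s i<) with Consec-applyUpTo⁺ (f ∘ suc) n i i<
... | xs , ys , eq = f 0 ∷ xs , ys , cong (f 0 ∷_) eq

Consec-applyUpTo⁻ : ∀ (f : ℕ → ℕ) n {u v} → Consec u v (applyUpTo f n) → ∃[ i ] (suc i ℕ.< n × u ≡ f i × v ≡ f (suc i))
Consec-applyUpTo⁻ f (suc zero)    ([]     , ys , ())
Consec-applyUpTo⁻ f (suc (suc n)) ([]     , ys , refl) = 0 , ℕ.s≤s (ℕ.s≤s ℕ.z≤n) , refl , refl
Consec-applyUpTo⁻ f zero          (x ∷ xs , ys , ())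
Consec-applyUpTo⁻ f (suc n)       (x ∷ xs , ys , eq) with Consec-applyUpTo⁻ (f ∘ suc) n (xs , ys , proj₂ (∷-injective eq))
... | i , i< , u≡ , v≡ = suc i , ℕ.s≤s i< , u≡ , v≡

module SpineWithLeaves (n : ℕ) (ℓ : ℕ → ℕ) where

  spec : List (ℕ × ℕ)
  spec = map (λ i → (i , ℓ i)) (upTo n)

  edges : List Edge
  edges = pathEdges (n ∸ 1) ++ leafEdges spec n

  keys : map proj₁ spec ≡ upTo n
  keys = trans (sym (map-∘ (upTo n))) (map-id (upTo n))

  private
    ∈-leaves : ∀ {e} → e ∈ leafEdges spec n → proj₁ e ℕ.< n × n ℕ.≤ proj₂ e
    ∈-leaves e∈ with ∈-leafEdges spec e∈
    ... | k∈ , n≤ = ∈-upTo⁻ (subst (_ ∈_) keys k∈) , n≤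

    ∈-path : ∀ {e} → e ∈ pathEdges (n ∸ 1) → ∃[ i ] (suc i ℕ.< n × e ≡ (i , suc i))
    ∈-path e∈ with ∈-pathEdges (n ∸ 1) e∈
    ... | i , i< , refl = i , <∸1 n i< , refl
      where
      <∸1 : ∀ n {i} → i ℕ.< n ∸ 1 → suc i ℕ.< n
      <∸1 (suc n) i< = ℕ.s≤s i<

  degree-edges : ∀ {v} → v ℕ.< n → degree edges v ≡ degree (pathEdges (n ∸ 1)) v ℕ.+ ℓ v
  degree-edges {v} v<n = trans (degree-++ (pathEdges (n ∸ 1)) (leafEdges spec n) v)
    (cong (degree (pathEdges (n ∸ 1)) v ℕ.+_) (degree-leafEdges spec (subst Unique (sym keys) (Uniqueₚ.upTo⁺ n))
      (∈-map⁺ (λ i → (i , ℓ i)) (∈-upTo⁺ v<n)) v<n))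

  shape : Shape edges (upTo n)
  shape = record
    { unique   = Uniqueₚ.upTo⁺ n
    ; classify = λ {e} e∈ → classify (∈-++⁻ (pathEdges (n ∸ 1)) e∈)
    ; once     = once
    }
    where
    classify : ∀ {e} → e ∈ pathEdges (n ∸ 1) ⊎ e ∈ leafEdges spec n →
      (∃[ u ] ∃[ v ] (Consec u v (upTo n) × SameEdge e (u , v)))
      ⊎ (∃[ v ] ∃[ u ] (v ∈ upTo n × u ∉ upTo n × SameEdge e (v , u) × (∀ {f} → f ∈ edges → Inc u f → Inc v f)))
    classify (inj₁ e∈) with ∈-path e∈
    ... | i , i< , refl = inj₁ (i , suc i , Consec-applyUpTo⁺ id n i i< , inj₁ (refl , refl))
    classify {v , u} (inj₂ e∈) with ∈-leaves e∈
    ... | v<n , n≤u = inj₂ (v , u , ∈-upTo⁺ v<n , (λ u∈ → ℕₚ.<⇒≱ (∈-upTo⁻ u∈) n≤u) , inj₁ (refl , refl) ,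
        λ {f} f∈ → only (∈-++⁻ (pathEdges (n ∸ 1)) f∈))
      where
      only : ∀ {f} → f ∈ pathEdges (n ∸ 1) ⊎ f ∈ leafEdges spec n → Inc u f → Inc v f
      only (inj₁ f∈) uf with ∈-path f∈
      only (inj₁ f∈) (inj₁ refl) | i , i< , refl = contradiction n≤u (ℕₚ.<⇒≱ (ℕₚ.<⇒≤ i<))
      only (inj₁ f∈) (inj₂ refl) | i , i< , refl = contradiction n≤u (ℕₚ.<⇒≱ i<)
      only (inj₂ f∈) (inj₁ refl) = contradiction n≤u (ℕₚ.<⇒≱ (proj₁ (∈-leaves f∈)))
      only (inj₂ f∈) (inj₂ refl) = inj₁ (leafEdges-owner spec f∈ e∈)

    distinct : AllPairs (λ e f → ¬ SameEdge e f) (pathEdges (n ∸ 1))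
    distinct = AllPairsₚ.map⁺ (AllPairsₚ.applyUpTo⁺₁ id (n ∸ 1) λ
      { i<j _ (inj₁ (refl , _)) → ℕₚ.n≮n _ i<j
      ; i<j _ (inj₂ (refl , _)) → ℕₚ.n≮n _ (ℕₚ.<⇒≤ i<j) })

    once : ∀ u v → Consec u v (upTo n) → Σℚ (λ e → ⟦ same e (u , v) ⟧) edges ≡ 1ℚ
    once u v c with Consec-applyUpTo⁻ id n c
    ... | i , i< , refl , refl = trans (Σℚ-++ (λ e → ⟦ same e (i , suc i) ⟧) (pathEdges (n ∸ 1)) (leafEdges spec n))
      (trans (cong₂ _+_
        (Σ-same (pathEdges (n ∸ 1)) (i , suc i) distinct
          (∈-map⁺ (λ i → (i , suc i)) (∈-upTo⁺ (ℕₚ.∸-monoˡ-≤ 1 i<))) (inj₁ (refl , refl)))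
        (Σℚ-0 (leafEdges spec n) λ {e} e∈ → cong ⟦_⟧ (same-false (leaf-differs e∈))))
        (+-identityʳ 1ℚ))
      where
      leaf-differs : ∀ {e} → e ∈ leafEdges spec n → ¬ SameEdge e (i , suc i)
      leaf-differs e∈ (inj₁ (_ , refl)) = ℕₚ.<⇒≱ i< (proj₂ (∈-leaves e∈))
      leaf-differs e∈ (inj₂ (_ , refl)) = ℕₚ.<⇒≱ (ℕₚ.<⇒≤ i<) (proj₂ (∈-leaves e∈))

-- The bound 2 ≤ eSeq keeps the subtractions in leafCount from truncating.
degree-𝒮 : ∀ c d D {i} → i ℕ.< 2 ℕ.+ length D → 2 ℕ.≤ eSeq (c ∷ d ∷ D) (suc i) →
           degree (E (𝒮 (c ∷ d ∷ D))) i ≡ eSeq (c ∷ d ∷ D) (suc i)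
degree-𝒮 c d D {i} i<n 2≤e = trans (SpineWithLeaves.degree-edges (2 ℕ.+ length D) (λ i → leafCount (c ∷ d ∷ D) (suc i)) i<n) (total i i<n 2≤e)
  where
  n = length D
  total : ∀ i → i ℕ.< 2 ℕ.+ n → 2 ℕ.≤ eSeq (c ∷ d ∷ D) (suc i) →
          degree (pathEdges (suc n)) i ℕ.+ leafCount (c ∷ d ∷ D) (suc i) ≡ eSeq (c ∷ d ∷ D) (suc i)
  total zero    _ 2≤e = trans (cong (ℕ._+ (eSeq (c ∷ d ∷ D) 1 ∸ 1)) (degree-path-first n)) (ℕₚ.m+[n∸m]≡n (ℕₚ.<⇒≤ 2≤e))
  total (suc v) (ℕ.s≤s v<) 2≤e with ℕₚ.m<1+n⇒m<n∨m≡n v<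
  ... | inj₂ refl = trans (cong₂ ℕ._+_ (degree-path-last n) (end (ℕₚ.≤⇒≤ᵇ (ℕₚ.≤-refl {n})))) (ℕₚ.m+[n∸m]≡n (ℕₚ.<⇒≤ 2≤e))
    where
    end : T (n ≤ᵇ n) → leafCount (c ∷ d ∷ D) (suc (suc n)) ≡ eSeq (c ∷ d ∷ D) (suc (suc n)) ∸ 1
    end t with suc n ≤ᵇ suc n in eq
    ... | true  = refl
    ... | false = contradiction (ℕₚ.≤⇒≤ᵇ (ℕₚ.≤-refl {suc n})) (subst T eq)
  ... | inj₁ v<n = trans (cong₂ ℕ._+_ (degree-path-inner (suc n) v (ℕ.s≤s v<n)) inner) (ℕₚ.m+[n∸m]≡n 2≤e)
    where
    inner : leafCount (c ∷ d ∷ D) (suc (suc v)) ≡ eSeq (c ∷ d ∷ D) (suc (suc v)) ∸ 2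
    inner with suc n ≤ᵇ suc v in eq
    ... | false = refl
    ... | true  = contradiction (ℕₚ.≤ᵇ⇒≤ (suc n) (suc v) (subst T (sym eq) _)) (ℕₚ.<⇒≱ (ℕ.s≤s v<n))

-- The matching polynomial of `𝒮 D` and the comparison

module _ (x : ℚ) where
  open Continuant x
  open Matching x using (M≡W)

  M-𝒮-star : ∀ d → M (𝒮 (d ∷ [])) x ≡ 1ℚ + x * ℕ→ℚ d
  M-𝒮-star d = trans (M≡W (𝒮 (d ∷ []))) (trans
    (Spine.W-single x (E (𝒮 (d ∷ []))) (upTo 1) (SpineWithLeaves.shape 1 (λ i → leafCount (d ∷ []) (suc i))) 0 refl)
    (cong (λ k → 1ℚ + x * ℕ→ℚ k) (SpineWithLeaves.degree-edges 1 (λ i → leafCount (d ∷ []) (suc i)) (ℕ.s≤s ℕ.z≤n))))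

  M-𝒮-path : ∀ c d D → All (2 ℕ.≤_) (c ∷ d ∷ D) →
             M (𝒮 (c ∷ d ∷ D)) x ≡ K (0 ∷ map (_∸ 2) (spineDegrees (c ∷ d ∷ D)) ++ [ 0 ])
  M-𝒮-path c d D 2≤ = trans (M≡W (𝒮 L)) (trans
    (Spine.W-path x (E (𝒮 L)) (upTo (length L)) (SpineWithLeaves.shape (length L) (λ i → leafCount L (suc i)))
      (λ i → eSeq L (suc i) ∸ 2) deg≡ 0 1 _ refl)
    (cong (λ w → K (0 ∷ w ++ [ 0 ])) (map-∘ {g = _∸ 2} {f = λ i → eSeq L (suc i)} (upTo (length L)))))
    where
    L = c ∷ d ∷ D
    -- The spine degrees are a permutation of `L` and inherit its lower bound.
    2≤e : All (λ i → 2 ℕ.≤ eSeq L (suc i)) (upTo (length L))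
    2≤e = Allₚ.map⁻ (All-resp-↭ (↭-sym (Zigzag-↭ (spineDegrees-zigzag L))) 2≤)
    deg≡ : ∀ {v} → v ∈ upTo (length L) → degree (E (𝒮 L)) v ≡ 2 ℕ.+ (eSeq L (suc v) ∸ 2)
    deg≡ v∈ = trans (degree-𝒮 c d D (∈-upTo⁻ v∈) (All.lookup 2≤e v∈)) (sym (ℕₚ.m+[n∸m]≡n (All.lookup 2≤e v∈)))

theorem2 : (D : List ℕ) → D ≢ []
    → ∃[ G ] (IsCaterpillar G × ReducedDegSeq G D)
    → (x : ℚ) → 0ℚ < x
    → (H : Graph) → IsCaterpillar H → ReducedDegSeq H D
    → M (𝒮 D) x ≤ M H x
theorem2 []          D≢[] _ x 0<x H catH rdsH = contradiction refl D≢[]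
theorem2 (d ∷ [])    _    _ x 0<x H catH rdsH =
  ≤-reflexive (trans (M-𝒮-star x d) (sym (Caterpillar.M-star H catH x rdsH)))
theorem2 (c ∷ d ∷ D) _    _ x 0<x H catH rdsH = compare (Caterpillar.M-path H catH x rdsH)
  where
  open Continuant x
  compare : All (2 ℕ.≤_) (c ∷ d ∷ D) × ∃[ w ] (w ↭ map (_∸ 2) (c ∷ d ∷ D) × M H x ≡ K (0 ∷ w ++ [ 0 ])) →
            M (𝒮 (c ∷ d ∷ D)) x ≤ M H x
  -- Both polynomials are now continuants of rearrangements of the same letters. Subtracting 2 is
  -- monotone, so these letters are still sorted.
  compare (2≤D , w , w↭ , MH≡) = subst₂ _≤_ (sym (M-𝒮-path x c d D 2≤D)) (sym MH≡)
    (Greedy.zigzag-minimal-0 x 0<x w (Zigzag-map (_∸ 2) (spineDegrees-zigzag (c ∷ d ∷ D)))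
      (AllPairsₚ.map⁺ (AllPairs.map (ℕₚ.∸-monoˡ-≤ 2) (proj₁ rdsH))) w↭)
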